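{- Let $m\in\mathbb{N}$ and $A\subseteq\mathbb{N}^m$. The following two statements are equivalent. (1) There exist functions $\alpha:\mathcal{P}_f(\mathbb{N}^{\mathbb{N}})\to\mathbb{N}$ and $H:\mathcal{P}_f(\mathbb{N}^{\mathbb{N}})\to\mathcal{P}_f(\mathbb{N})$ such that (a) if $F,G\in\mathcal{P}_f(\mathbb{N}^{\mathbb{N}})$ and $F\subsetneq G$, then $\max H(F)<\min H(G)$; and (b) whenever $n\in\mathbb{N}$ with $n\ge m$, $G_1\subsetneq G_2\subsetneq\cdots\subsetneq G_n$ in $\mathcal{P}_f(\mathbb{N}^{\mathbb{N}})$, $\beta_1<\beta_2<\cdots<\beta_m$ in $\mathcal{P}_f(\mathbb{N})$ with $\max\beta_m\le n$, and $f_i\in G_i$ for every $i\in\{1,\ldots,n\}$, one has $$\left(\sum_{i\in\beta_1}\Bigl(\alpha(G_i)+\sum_{t\in H(G_i)}f_i(t)\Bigr),\ldots,\sum_{i\in\beta_m}\Bigl(\alpha(G_i)+\sum_{t\in H(G_i)}f_i(t)\Bigr)\right)\in A.$$ (2) There exists an idempotent $p$ in $(\mathcal{J},+)$ such that $A\in\bigotimes_{i=1}^m p$.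
   Context: $\mathbb{N}$ is the set of positive integers; $\mathcal{P}_f(X)$ is the set of nonempty finite subsets of $X$; $\mathbb{N}^{\mathbb{N}}$ is the set of all functions $\mathbb{N}\to\mathbb{N}$. For $\beta,\gamma\in\mathcal{P}_f(\mathbb{N})$, $\beta<\gamma$ means $\max\beta<\min\gamma$. $\beta\mathbb{N}$ is the set of ultrafilters on $\mathbb{N}$, with the operation: $A\in p+q$ iff $\{x\in\mathbb{N}:-x+A\in q\}\in p$, where $-x+A=\{y\in\mathbb{N}:x+y\in A\}$. An ultrafilter $p$ is idempotent if $p+p=p$. A set $A\subseteq\mathbb{N}$ is a $J$-set if for every $F\in\mathcal{P}_f(\mathbb{N}^{\mathbb{N}})$ there exist $a\in\mathbb{N}$ and $\beta\in\mathcal{P}_f(\mathbb{N})$ such that $a+\sum_{t\in\beta}f(t)\in A$ for all $f\in F$. $\mathcal{J}=\{p\in\beta\mathbb{N}:\text{every }A\in p\text{ is a }J\text{ -set}\}$; it is a two-sided ideal of $(\beta\mathbb{N},+)$. Tensor products: for ultrafilters $p_1,\ldots,p_k$ on $\mathbb{N}$, $\bigotimes_{i=1}^k p_i$ is the ultrafilter on $\mathbb{N}^k$ defined recursively by $\bigotimes_{i=1}^1p_i=p_1$, and, for $A\subseteq\mathbb{N}^{k+1}$, $A\in\bigotimes_{i=1}^{k+1}p_i$ iff $\{(x_1,\ldots,x_k)\in\mathbb{N}^k:\{x_{k+1}\in\mathbb{N}:(x_1,\ldots,x_{k+1})\in A\}\in p_{k+1}\}\in\bigotimes_{i=1}^kp_i$.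 $\bigotimes_{i=1}^mp$ is the case $p_i=p$ for all $i$. -}

module Defs where

open import Level using (0ℓ) renaming (suc to lsuc)
open import Algebra.Definitions using (_IdempotentOn_)
open import Data.Fin using (Fin; zero; fromℕ; inject₁)
open import Data.List.Extrema.Nat using (argmin; argmax)
open import Data.List.NonEmpty as List⁺ using (List⁺; toList; foldr₁)
import Data.List.Membership.Setoid as Membership
import Data.List.Relation.Unary.Unique.Setoid as Uniqueness
open import Data.Nat as ℕ using (ℕ; zero; suc; NonZero)
open import Data.Product using (∃; _×_; _,_; proj₁; proj₂)
open import Data.Sum as Sum using (_⊎_; inj₁; inj₂)
open import Data.Vec using (Vec; []; _∷_; _∷ʳ_)
open import Function using (_∘_)
open import Function.Bundles using (Func; _⟨$⟩_)
open import Relation.Binary.Bundles using (Setoid)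
open import Relation.Binary.Core using (REL)
open import Relation.Binary.Definitions using (_Respectsˡ_; _Respectsʳ_)
open import Relation.Binary.PropositionalEquality using (setoid; _→-setoid_)
open import Relation.Nullary using (¬_; contradiction)
open import Relation.Unary using (Pred; U; ∅; ∁; _∩_; _⊆_; _⊂_; _≐_)
open import Relation.Unary.Properties using (≐-refl; ≐-sym; ≐-trans)

-- Choice for sets with an equivalence relation as equality.  The version
-- without setoids is provable from the type-theoretic meaning of ∃; the
-- content here is that the chosen function respects the equalities, as any
-- function between sets does classically.
AxiomOfChoice : Set₁
AxiomOfChoice =
  (S T : Setoid 0ℓ 0ℓ) →
  let module S = Setoid S
      module T = Setoid T
  in (R : REL S.Carrier T.Carrier 0ℓ) →
     R Respectsˡ S._≈_ → R Respectsʳ T._≈_ →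
     (∀ x → ∃ λ y → R x y) →
     ∃ λ (f : Func S T) → ∀ x → R x (f ⟨$⟩ x)

------------------------------------------------------------------------
-- Positive integers

record ℕ⁺ : Set where
  constructor mkℕ⁺
  field
    val          : ℕ
    .{{nonZero}} : NonZero val

open ℕ⁺ public using (val)

infixl 6 _+⁺_

_+⁺_ : ℕ⁺ → ℕ⁺ → ℕ⁺
mkℕ⁺ m +⁺ mkℕ⁺ n = mkℕ⁺ (m ℕ.+ n) {{+-nonZero m n}}
  where
  +-nonZero : ∀ m n → .{{NonZero m}} → NonZero (m ℕ.+ n)
  +-nonZero (suc m) n = _

suc⁺ : ℕ⁺ → ℕ⁺
suc⁺ (mkℕ⁺ n) = mkℕ⁺ (suc n)

ℕ⁺-setoid : Setoid 0ℓ 0ℓ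
ℕ⁺-setoid = setoid ℕ⁺

-- Functions are equal when they agree pointwise.
ℕ⁺^ℕ⁺ : Setoid 0ℓ 0ℓ
ℕ⁺^ℕ⁺ = ℕ⁺ →-setoid ℕ⁺

------------------------------------------------------------------------
-- Nonempty finite subsets

-- A nonempty finite set is given by an enumeration without repetitions.
-- Different enumerations of a set are identified by the equality _≈ᶠ_.
record 𝒫f (S : Setoid 0ℓ 0ℓ) : Set where
  field
    elements : List⁺ (Setoid.Carrier S)
    unique   : Uniqueness.Unique S (toList elements)

open 𝒫f public

module _ {S : Setoid 0ℓ 0ℓ} where
  open Setoid S using (Carrier)

  infix 4 _∈ᶠ_ _⊊_ _≈ᶠ_

  _∈ᶠ_ : Carrier → 𝒫f S → Set
  x ∈ᶠ F = Membership._∈_ S x (toList (elements F))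

  _⊊_ : 𝒫f S → 𝒫f S → Set
  F ⊊ G = (_∈ᶠ F) ⊂ (_∈ᶠ G)

  _≈ᶠ_ : 𝒫f S → 𝒫f S → Set
  F ≈ᶠ G = (_∈ᶠ F) ≐ (_∈ᶠ G)

𝒫f-setoid : Setoid 0ℓ 0ℓ → Setoid 0ℓ 0ℓ
𝒫f-setoid S = record
  { Carrier       = 𝒫f S
  ; _≈_           = _≈ᶠ_
  ; isEquivalence = record { refl = ≐-refl ; sym = ≐-sym ; trans = ≐-trans }
  }

minᶠ maxᶠ : 𝒫f ℕ⁺-setoid → ℕ⁺
minᶠ β = argmin val (List⁺.head (elements β)) (List⁺.tail (elements β))
maxᶠ β = argmax val (List⁺.head (elements β)) (List⁺.tail (elements β))

infix 4 _<ᶠ_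

_<ᶠ_ : 𝒫f ℕ⁺-setoid → 𝒫f ℕ⁺-setoid → Set
β <ᶠ γ = val (maxᶠ β) ℕ.< val (minᶠ γ)

∑ : 𝒫f ℕ⁺-setoid → (ℕ⁺ → ℕ⁺) → ℕ⁺
∑ β f = foldr₁ _+⁺_ (List⁺.map f (elements β))

syntax ∑ β (λ t → e) = ∑[ t ∈ β ] e

------------------------------------------------------------------------
-- Ultrafilters

-- Upward closure makes membership in an ultrafilter independent of the
-- predicate chosen to represent a subset.
record IsUltrafilter {X : Set} (𝒰 : Pred (Pred X 0ℓ) 0ℓ) : Set₁ where
  field
    univ    : 𝒰 U
    upward  : ∀ {A B} → A ⊆ B → 𝒰 A → 𝒰 B
    meet    : ∀ {A B} → 𝒰 A → 𝒰 B → 𝒰 (A ∩ B)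
    proper  : ¬ 𝒰 ∅
    maximal : ∀ A → 𝒰 A ⊎ 𝒰 (∁ A)

record Ultrafilter (X : Set) : Set₁ where
  field
    sets          : Pred (Pred X 0ℓ) 0ℓ
    isUltrafilter : IsUltrafilter sets

  open IsUltrafilter isUltrafilter public

open Ultrafilter using (sets)

module _ {X : Set} where

  infix 4 _∋_ _≈ᵘ_

  _∋_ : Ultrafilter X → Pred X 0ℓ → Set
  p ∋ A = sets p A

  _≈ᵘ_ : Ultrafilter X → Ultrafilter X → Set₁
  p ≈ᵘ q = sets p ≐ sets q

βℕ : Set₁
βℕ = Ultrafilter ℕ⁺

-- The common form of p + q and of one step of the tensor product: for
-- _⋆_ : X → Y → Z, the sets A with {x ∣ {y ∣ x ⋆ y ∈ A} ∈ q} ∈ p.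
extend : ∀ {X Y Z : Set} → (X → Y → Z) → Ultrafilter X → Ultrafilter Y → Ultrafilter Z
extend _⋆_ p q = record
  { sets          = λ A → p ∋ λ x → q ∋ λ y → A (x ⋆ y)
  ; isUltrafilter = record
    { univ    = p.upward (λ _ → q.univ) p.univ
    ; upward  = λ A⊆B → p.upward (q.upward A⊆B)
    ; meet    = λ A∈ B∈ → p.upward (λ (a , b) → q.meet a b) (p.meet A∈ B∈)
    ; proper  = λ ∅∈ → p.proper (p.upward q.proper ∅∈)
    ; maximal = λ A → Sum.map₂
        (p.upward λ {x} A∉ → Sum.[ (λ A∈ → contradiction A∈ A∉) , (λ ∁A∈ → ∁A∈) ] (q.maximal (λ y → A (x ⋆ y))))
        (p.maximal (λ x → q ∋ λ y → A (x ⋆ y)))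
    }
  }
  where
  module p = Ultrafilter p
  module q = Ultrafilter q

infixl 6 _⊕_

_⊕_ : βℕ → βℕ → βℕ
_⊕_ = extend _+⁺_

IsIdempotent : βℕ → Set₁
IsIdempotent p = _IdempotentOn_ _≈ᵘ_ _⊕_ p

-- The tensor product of k + 1 ultrafilters.
⨂ : ∀ {k} → (Fin (suc k) → βℕ) → Ultrafilter (Vec ℕ⁺ (suc k))
⨂ {zero}  p = singletons (p zero)
  where
  singletons : βℕ → Ultrafilter (Vec ℕ⁺ 1)
  singletons q = record
    { sets          = λ A → q ∋ λ x → A (x ∷ [])
    ; isUltrafilter = record
      { univ    = q.univ
      ; upward  = λ A⊆B → q.upward A⊆B
      ; meet    = q.meet
      ; proper  = q.proper
      ; maximal = λ A → q.maximal (λ x → A (x ∷ []))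
      }
    }
    where module q = Ultrafilter q
⨂ {suc k} p = extend _∷ʳ_ (⨂ (p ∘ inject₁)) (p (fromℕ (suc k)))

------------------------------------------------------------------------
-- J-sets

IsJSet : Pred ℕ⁺ 0ℓ → Set
IsJSet A =
  (F : 𝒫f ℕ⁺^ℕ⁺) →
  ∃ λ (a : ℕ⁺) → ∃ λ (β : 𝒫f ℕ⁺-setoid) →
  ∀ f → f ∈ᶠ F → A (a +⁺ (∑[ t ∈ β ] f t))

𝒥 : Pred βℕ (lsuc 0ℓ)
𝒥 p = ∀ A → p ∋ A → IsJSet A

{-# OPTIONS --safe #-}
-- From (1) to (2): for a finite set F of functions let T F be the set of sums
-- of terms α G + ∑ (H G) f along chains of supersets of F.  If x ∈ T F is
-- realized by a chain ending in G, then x + T G ⊆ T F, so the ultrafilters that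
-- contain every T F form a closed subsemigroup, and so do those among them that
-- lie in 𝒥.  The latter is nonempty: if T F were covered by finitely many sets
-- that are not J-sets, collect the witnesses of this in one finite set of
-- functions and use it as an alphabet; words then label elements of T F, and a
-- monochromatic Hales–Jewett line puts a + ∑ β f, for every f in the alphabet,
-- into one of these sets, against its witness.  By Ellis's lemma there is an idempotent p in this
-- semigroup, and any p containing every T F has A in its tensor power.
-- Closed subsets of βℕ are represented by filters throughout.
--
-- From (2) to (1): choose (α F , H F) by recursion on the size of F.  Every
-- partial tuple of block sums below F puts finitely many conditions on the next
-- term, each of which holds on a member of p of the form B* = {x ∈ B : -x + B ∈ p};
-- the intersection of these members is a J-set.
module Submission where

open import Defs
open import Level using (0ℓ)
open import Algebra.Properties.CommutativeSemigroup using (interchange)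
open import Axiom.ExcludedMiddle using (ExcludedMiddle)
open import Data.Bool using (Bool; true; false; T; not; _∧_; _∨_)
open import Data.Bool.Properties using (∨-identityʳ)
open import Data.Fin as Fin using (Fin; zero; suc; funToFin; finToFun)
open import Data.Fin.Properties using (finToFun-funToFin; injective⇒≤)
open import Data.List as List using (List; []; _∷_; _ʳ++_; length; filter; deduplicate; reverse)
open import Data.List.Extrema.Nat as Extrema using ()
import Data.List.Membership.Setoid as Membership
import Data.List.Membership.Setoid.Properties as Mem
open import Data.List.Membership.Propositional using (find) renaming (_∈_ to _∈ₗ_)
open import Data.List.Membership.Propositional.Properties using (∈-lookup; ∈-++⁺ˡ; ∈-++⁺ʳ; ∈-map⁺)
open import Data.List.NonEmpty as List⁺ using (List⁺; foldr₁; _∷_)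
open import Data.List.Properties using (map-++; map-∘; map-cong-local; length-ʳ++; unfold-reverse; reverse-involutive)
open import Data.List.Relation.Binary.Permutation.Propositional using (_↭_; ↭-sym; ↭⇒↭ₛ)
open import Data.List.Relation.Binary.Permutation.Propositional.Properties using (∈-resp-↭; map⁺)
open import Data.List.Relation.Binary.Permutation.Setoid.Properties using (Unique-resp-↭)
open import Data.List.Relation.Unary.All as All using (All; []; _∷_)
import Data.List.Relation.Unary.All.Properties as AllP
open import Data.List.Relation.Unary.AllPairs as AllPairs using (AllPairs; []; _∷_)
open import Data.List.Relation.Unary.Any as Any using (Any; here; there)
import Data.List.Relation.Unary.Any.Properties as AnyP
open import Data.List.Relation.Unary.Linked as LinkedL using ([]; [-]; _∷_)
open import Data.List.Relation.Unary.Linked.Properties using (Linked⇒AllPairs)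
import Data.List.Relation.Unary.Unique.Setoid as Uniqueness
import Data.List.Relation.Unary.Unique.Setoid.Properties as UniqueP
import Data.List.Relation.Unary.Unique.DecSetoid.Properties as UniqueDec
import Data.List.Sort as Sort
open import Data.Maybe as Maybe using (Maybe; just; nothing; fromMaybe)
open import Data.Nat as ℕ using (ℕ; zero; suc; _≤_; _<_; _^_; s≤s; z≤n; NonZero; >-nonZero; >-nonZero⁻¹)
open import Data.Nat.ListAction using (sum)
open import Data.Nat.ListAction.Properties using (sum-++; sum-↭)
open import Data.Nat.Properties as ℕ using (≤-decTotalOrder; +-commutativeSemigroup)
open import Data.Product using (∃; _×_; _,_; proj₁; proj₂)
open import Data.Sum as Sum using (_⊎_; inj₁; inj₂; [_,_]′)
open import Data.Unit using (⊤; tt)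
open import Data.Vec as Vec using (Vec; []; _∷_; map; last; toList)
import Data.Vec.Properties as Vec
open import Data.Vec.Relation.Unary.Any as VecAny using (here; there)
open import Data.Vec.Relation.Unary.Any.Properties using (++⁺ˡ; ++⁺ʳ)
open import Data.Vec.Relation.Unary.Linked using (Linked; []; [-]; _∷_)
open import Function using (_∘_; id; flip)
open import Function.Bundles using (Func; _⟨$⟩_; _⇔_; mk⇔)
open import Relation.Binary.Bundles using (Setoid; DecSetoid)
import Relation.Binary.Construct.On as On
open import Relation.Binary.PropositionalEquality as ≡ using (_≡_; refl; sym; trans; cong; cong₂; subst; _→-setoid_)
open import Relation.Nullary using (¬_; Dec; yes; no; contradiction)
open import Relation.Nullary.Decidable using (⌊_⌋; ¬?; decidable-stable; toWitness; fromWitness)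
open import Relation.Unary using (Pred; U; ∅; ∁; _∩_; _⊆_; _≐_)

-- Enumerations without repetitions and the pigeonhole principle.

module _ (S : Setoid 0ℓ 0ℓ) where

  open Setoid S using (_≈_) renaming (trans to ≈-trans; sym to ≈-sym)
  open Membership S using (_∈_)
  open Uniqueness S using (Unique)

  unique-lookup : ∀ {xs} → Unique xs → ∀ {i j} → List.lookup xs i ≈ List.lookup xs j → i ≡ j
  unique-lookup             (x∉ ∷ u) {zero}  {zero}  _  = refl
  unique-lookup {_ ∷ xs}    (x∉ ∷ u) {zero}  {suc j} eq =
    contradiction (Mem.∈-resp-≈ S (≈-sym eq) (Mem.∈-lookup S xs j)) (Mem.All[≉]⇒∉ S x∉)
  unique-lookup {_ ∷ xs}    (x∉ ∷ u) {suc i} {zero}  eq =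
    contradiction (Mem.∈-resp-≈ S eq (Mem.∈-lookup S xs i)) (Mem.All[≉]⇒∉ S x∉)
  unique-lookup             (x∉ ∷ u) {suc i} {suc j} eq = cong suc (unique-lookup u eq)

  -- Pigeonhole: each index of `xs` goes to a position of an equal entry of `ys`, and a shared
  -- position would make two entries of `xs` equal.
  unique-⊆⇒length≤ : ∀ {xs ys} → Unique xs → (_∈ xs) ⊆ (_∈ ys) → length xs ≤ length ys
  unique-⊆⇒length≤ {xs} {ys} u xs⊆ys = injective⇒≤ {f = position} λ {i} {j} eq →
    unique-lookup u (Mem.index-injective S (located i) (located j) eq)
    where
    located = λ i → xs⊆ys (Mem.∈-lookup S xs i)
    position = λ i → Any.index (located i)

-- Choice and Zorn's lemma

-- Subsets coded by Bool-valued functions: families of subsets, and families of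
-- families, then stay in Set, where excluded middle and choice apply.
Sub : Set → Set
Sub X = X → Bool

infix 4 _∈ₛ_ _⊑_

_∈ₛ_ : ∀ {X : Set} → X → Sub X → Set
x ∈ₛ A = T (A x)

_⊑_ : ∀ {X : Set} → Sub X → Sub X → Set
A ⊑ B = ∀ x → x ∈ₛ A → x ∈ₛ B

T-injective : ∀ {a b} → (T a → T b) → (T b → T a) → a ≡ b
T-injective {false} {false} _ _ = refl
T-injective {false} {true}  _ g with () ← g tt
T-injective {true}  {false} f _ with () ← f tt
T-injective {true}  {true}  _ _ = refl

module Choice (em : ExcludedMiddle 0ℓ) (ac : AxiomOfChoice) where

  ⟦_⟧ : ∀ {X : Set} → Pred X 0ℓ → Sub X
  ⟦ P ⟧ x = ⌊ em {P x} ⌋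

  ⟦⟧⁺ : ∀ {X : Set} (P : Pred X 0ℓ) {x} → P x → x ∈ₛ ⟦ P ⟧
  ⟦⟧⁺ P = fromWitness

  ⟦⟧⁻ : ∀ {X : Set} (P : Pred X 0ℓ) {x} → x ∈ₛ ⟦ P ⟧ → P x
  ⟦⟧⁻ P = toWitness

  selector : (X : Set) → X → ∃ λ (ε : Pred X 0ℓ → X) →
    (∀ P → ∃ P → P (ε P)) × (∀ P Q → P ≐ Q → ε P ≡ ε Q)
  selector X x₀ with ac (X →-setoid Bool) (≡.setoid X) R R-respˡ (λ { refl r → r }) R-total
    where
    R : Sub X → X → Set
    R A x = ∃ (_∈ₛ A) → x ∈ₛ A

    R-respˡ : ∀ {x A B} → (∀ y → A y ≡ B y) → R A x → R B x
    R-respˡ A≗B r (y , y∈B) =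
      ≡.subst T (A≗B _) (r (y , ≡.subst T (≡.sym (A≗B y)) y∈B))

    R-total : ∀ A → ∃ (R A)
    R-total A with em {∃ (_∈ₛ A)}
    ... | yes (x , x∈A) = x , λ _ → x∈A
    ... | no  empty     = x₀ , λ ne → contradiction ne empty
  ... | f , f-spec =
    (λ P → f ⟨$⟩ ⟦ P ⟧) ,
    (λ P (x , px) → ⟦⟧⁻ P (f-spec ⟦ P ⟧ (x , ⟦⟧⁺ P px))) ,
    (λ P Q (P⊆Q , Q⊆P) → Func.cong f λ x →
      T-injective (⟦⟧⁺ Q ∘ P⊆Q ∘ ⟦⟧⁻ P) (⟦⟧⁺ P ∘ Q⊆P ∘ ⟦⟧⁻ Q))

  InSome : ∀ {Y : Set} → Sub (Sub Y) → Y → Set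
  InSome I y = ∃ λ A → A ∈ₛ I × y ∈ₛ A

  ⋃ : ∀ {Y : Set} → Sub (Sub Y) → Sub Y
  ⋃ I = ⟦ InSome I ⟧

  IsChain : ∀ {Y : Set} → Sub (Sub Y) → Set
  IsChain I = ∀ A B → A ∈ₛ I → B ∈ₛ I → A ⊑ B ⊎ B ⊑ A

  ChainClosed : ∀ {Y : Set} → (Sub Y → Set) → Set
  ChainClosed Φ = ∀ I → ∃ (_∈ₛ I) → IsChain I → (∀ A → A ∈ₛ I → Φ A) → Φ (⋃ I)

  Maximal : ∀ {Y : Set} → (Sub Y → Set) → Sub Y → Set
  Maximal Φ M = ∀ A → Φ A → M ⊑ A → A ⊑ M

  module Zorn {Y : Set} (Φ : Sub Y → Set) (A₀ : Sub Y) (Φ-A₀ : Φ A₀) 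
    (closed : ChainClosed Φ) (resp : ∀ {A B} → A ⊑ B → B ⊑ A → Φ A → Φ B) where

    -- Membership in `Φ` is a premise, so that every set has a successor; the last clause makes a
    -- fixed point of the successor map inside `Φ` maximal.
    Next : Sub Y → Sub Y → Set
    Next A B = A ⊑ B × (Φ A → Φ B × (B ⊑ A → Maximal Φ A))

    next-exists : ∀ A → ∃ (Next A)
    next-exists A with em {∃ λ B → Φ B × A ⊑ B × ¬ (B ⊑ A)}
    ... | yes (B , ΦB , A⊑B , B⋢A) = B , A⊑B , λ _ → ΦB , λ B⊑A → contradiction B⊑A B⋢A
    ... | no none = A , (λ _ → id) , λ ΦA → ΦA , λ _ B ΦB A⊑B → B⊑A B ΦB A⊑B
      where
      B⊑A : ∀ B → Φ B → A ⊑ B → B ⊑ A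
      B⊑A B ΦB A⊑B with em {B ⊑ A}
      ... | yes p = p
      ... | no ¬p = contradiction (B , ΦB , A⊑B , ¬p) none

    ε      = proj₁ (selector (Sub Y) A₀)
    ε-spec = proj₁ (proj₂ (selector (Sub Y) A₀))
    ε-ext  = proj₂ (proj₂ (selector (Sub Y) A₀))

    next : Sub Y → Sub Y
    next A = ε (Next A)

    next-spec : ∀ A → Next A (next A)
    next-spec A = ε-spec (Next A) (next-exists A)

    Next-resp : ∀ {A B} → A ⊑ B → B ⊑ A → ∀ {C} → Next B C → Next A C
    Next-resp A⊑B B⊑A (B⊑C , h) =
      (λ x → B⊑C x ∘ A⊑B x) ,
      λ ΦA → let ΦC , max = h (resp A⊑B B⊑A ΦA) in
        ΦC , λ C⊑A D ΦD A⊑D x → B⊑A x ∘ max (λ x → A⊑B x ∘ C⊑A x) D ΦD (λ x → A⊑D x ∘ B⊑A x) x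

    -- Codes with the same members need not be identical; extensionality of `ε` still gives them one
    -- and the same successor.
    next-cong : ∀ {A B} → A ⊑ B → B ⊑ A → next A ≡ next B
    next-cong A⊑B B⊑A = ε-ext _ _ (Next-resp B⊑A A⊑B , Next-resp A⊑B B⊑A)

    -- The Bourbaki–Witt tower: any two members are comparable, so the union of all
    -- members is a member that next does not enlarge.
    data Tower : Sub Y → Set where
      base : Tower A₀
      step : ∀ {A} → Tower A → Tower (next A)
      lim  : ∀ I → ∃ (_∈ₛ I) → (∀ A → A ∈ₛ I → Tower A) → Tower (⋃ I)

    ⊑-⋃ : ∀ (I : Sub (Sub Y)) {A} → A ∈ₛ I → A ⊑ ⋃ I
    ⊑-⋃ I A∈I y y∈A = ⟦⟧⁺ (InSome I) (_ , A∈I , y∈A)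

    ⋃-⊑ : ∀ (I : Sub (Sub Y)) {B} → (∀ A → A ∈ₛ I → A ⊑ B) → ⋃ I ⊑ B
    ⋃-⊑ I h y y∈⋃ with A , A∈I , y∈A ← ⟦⟧⁻ (InSome I) y∈⋃ = h A A∈I y y∈A

    ⊑-trans : ∀ {A B C : Sub Y} → A ⊑ B → B ⊑ C → A ⊑ C
    ⊑-trans A⊑B B⊑C x = B⊑C x ∘ A⊑B x

    A₀⊑ : ∀ {A} → Tower A → A₀ ⊑ A
    A₀⊑ base             = λ _ → id
    A₀⊑ (step {A} t)     = ⊑-trans (A₀⊑ t) (proj₁ (next-spec A))
    A₀⊑ (lim I (A , A∈I) ts) = ⊑-trans (A₀⊑ (ts A A∈I)) (⊑-⋃ I A∈I)

    split : ∀ (I : Sub (Sub Y)) {P Q : Sub Y → Set} → (∀ A → A ∈ₛ I → P A ⊎ Q A) →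
            (∃ λ A → A ∈ₛ I × P A) ⊎ (∀ A → A ∈ₛ I → Q A)
    split I {P} h with em {∃ λ A → A ∈ₛ I × P A}
    ... | yes p = inj₁ p
    ... | no ¬p = inj₂ λ A A∈I → [ (λ pA → contradiction (A , A∈I , pA) ¬p) , id ]′ (h A A∈I)

    -- The extreme elements of the Bourbaki-Witt argument: the successor of a tower member strictly
    -- below `B` does not jump past `B`.
    Gap : Sub Y → Set
    Gap B = ∀ {C} → Tower C → C ⊑ B → B ⊑ C ⊎ next C ⊑ B

    -- Induction on `A`. At a successor the gap property of `B` decides; at a union either one
    -- member already contains `next B` or all members stay inside `B`.
    gap-total : ∀ {A B} → Tower A → Gap B → Tower B → next B ⊑ A ⊎ A ⊑ B
    gap-total base gap tB = inj₂ (A₀⊑ tB)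
    gap-total (step {A} t) gap tB with gap-total t gap tB
    ... | inj₁ nB⊑A = inj₁ (⊑-trans nB⊑A (proj₁ (next-spec A)))
    ... | inj₂ A⊑B with gap t A⊑B
    ...   | inj₁ B⊑A  = inj₁ (λ y → ≡.subst (λ C → y ∈ₛ C) (next-cong B⊑A A⊑B))
    ...   | inj₂ nA⊑B = inj₂ nA⊑B
    gap-total (lim I _ ts) gap tB with split I (λ A A∈I → gap-total (ts A A∈I) gap tB)
    ... | inj₁ (A , A∈I , nB⊑A) = inj₁ (⊑-trans nB⊑A (⊑-⋃ I A∈I))
    ... | inj₂ A⊑B              = inj₂ (⋃-⊑ I A⊑B)

    -- At a successor, `C` inside `B` is settled by the gap property of `B`. At a union, either some
    -- member contains `next C`, or `C` contains every member and hence the union.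
    gap : ∀ {B} → Tower B → Gap B
    gap base tC C⊑ = inj₁ (A₀⊑ tC)
    gap (step {B} t) tC C⊑nB with gap-total tC (gap t) t
    ... | inj₁ nB⊑C = inj₁ nB⊑C
    ... | inj₂ C⊑B with gap t tC C⊑B
    ...   | inj₁ B⊑C  = inj₂ (λ y → ≡.subst (λ D → y ∈ₛ D) (next-cong C⊑B B⊑C))
    ...   | inj₂ nC⊑B = inj₂ (⊑-trans nC⊑B (proj₁ (next-spec B)))
    gap (lim I _ ts) {C} tC C⊑⋃ with split I dichotomy
      where
      dichotomy : ∀ A → A ∈ₛ I → next C ⊑ A ⊎ A ⊑ C
      dichotomy A A∈I with gap-total tC (gap (ts A A∈I)) (ts A A∈I)
      ... | inj₁ nA⊑C = inj₂ (⊑-trans (proj₁ (next-spec A)) nA⊑C)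
      ... | inj₂ C⊑A with gap (ts A A∈I) tC C⊑A
      ...   | inj₁ A⊑C  = inj₂ A⊑C
      ...   | inj₂ nC⊑A = inj₁ nC⊑A
    ... | inj₁ (A , A∈I , nC⊑A) = inj₂ (⊑-trans nC⊑A (⊑-⋃ I A∈I))
    ... | inj₂ A⊑C              = inj₁ (⋃-⊑ I A⊑C)

    total : ∀ {A B} → Tower A → Tower B → A ⊑ B ⊎ B ⊑ A
    total {A} {B} tA tB with gap-total tA (gap tB) tB
    ... | inj₁ nB⊑A = inj₂ (⊑-trans (proj₁ (next-spec B)) nB⊑A)
    ... | inj₂ A⊑B  = inj₁ A⊑B

    Tower⊆Φ : ∀ {A} → Tower A → Φ A
    Tower⊆Φ base           = Φ-A₀
    Tower⊆Φ (step {A} t)   = proj₁ (proj₂ (next-spec A) (Tower⊆Φ t))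
    Tower⊆Φ (lim I ne ts)  =
      closed I ne (λ A B A∈I B∈I → total (ts A A∈I) (ts B B∈I)) (λ A A∈I → Tower⊆Φ (ts A A∈I))

    -- The successor of the union of the tower belongs to the tower, so it lies inside that union;
    -- this triggers the last clause of `Next`.
    maximal-exists : ∃ λ M → Φ M × A₀ ⊑ M × Maximal Φ M
    maximal-exists = ⋃ ⟦ Tower ⟧ , Tower⊆Φ top , A₀⊑ top ,
      proj₂ (proj₂ (next-spec _) (Tower⊆Φ top)) (⊑-⋃ ⟦ Tower ⟧ (⟦⟧⁺ Tower (step top)))
      where
      top : Tower (⋃ ⟦ Tower ⟧)
      top = lim ⟦ Tower ⟧ (A₀ , ⟦⟧⁺ Tower base) (λ A → ⟦⟧⁻ Tower)

-- Filters and ultrafilters of coded sets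

val-injective : ∀ {m n} → val m ≡ val n → m ≡ n
val-injective refl = refl

+⁺-assoc : ∀ x y z → (x +⁺ y) +⁺ z ≡ x +⁺ (y +⁺ z)
+⁺-assoc x y z = val-injective (ℕ.+-assoc (val x) (val y) (val z))

+⁺-comm : ∀ x y → x +⁺ y ≡ y +⁺ x
+⁺-comm x y = val-injective (ℕ.+-comm (val x) (val y))

+⁺-interchange : ∀ w x y z → (w +⁺ x) +⁺ (y +⁺ z) ≡ (w +⁺ y) +⁺ (x +⁺ z)
+⁺-interchange w x y z = val-injective (interchange +-commutativeSemigroup (val w) (val x) (val y) (val z))

T-imp⁺ : ∀ {a b} → (T a → T b) → T (not a ∨ b)
T-imp⁺ {true}  f = f tt
T-imp⁺ {false} f = tt

T-imp⁻ : ∀ {a b} → T (not a ∨ b) → T a → T b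
T-imp⁻ {true} b _ = b

T-∧⁺ : ∀ {a b} → T a → T b → T (a ∧ b)
T-∧⁺ {true} _ b = b

T-∧⁻ : ∀ {a b} → T (a ∧ b) → T a × T b
T-∧⁻ {true} b = tt , b

T-not : ∀ {a} → T (not a) → ¬ T a
T-not {false} _ ()

T-not⁺ : ∀ {a} → ¬ T a → T (not a)
T-not⁺ {true}  h = contradiction tt h
T-not⁺ {false} _ = tt

module _ {X : Set} where

  record IsFilterₛ (ℱ : Sub (Sub X)) : Set where
    field
      univ   : (λ _ → true) ∈ₛ ℱ
      upward : ∀ {A B} → A ⊑ B → A ∈ₛ ℱ → B ∈ₛ ℱ
      meet   : ∀ {A B} → A ∈ₛ ℱ → B ∈ₛ ℱ → (λ x → A x ∧ B x) ∈ₛ ℱ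
      proper : ¬ (λ _ → false) ∈ₛ ℱ

    all : ∀ {A} → (∀ x → x ∈ₛ A) → A ∈ₛ ℱ
    all h = upward (λ x _ → h x) univ

    upward₂ : ∀ {A B C} → (∀ x → x ∈ₛ A → x ∈ₛ B → x ∈ₛ C) → A ∈ₛ ℱ → B ∈ₛ ℱ → C ∈ₛ ℱ
    upward₂ h A∈ B∈ = upward (λ x ab → let a , b = T-∧⁻ ab in h x a b) (meet A∈ B∈)

    disjoint : ∀ {A B} → A ∈ₛ ℱ → B ∈ₛ ℱ → ¬ (∀ x → x ∈ₛ A → ¬ x ∈ₛ B)
    disjoint A∈ B∈ h = proper (upward₂ (λ x a b → contradiction b (h x a)) A∈ B∈)

  record IsUltraₛ (p : Sub (Sub X)) : Set where
    field
      isFilter : IsFilterₛ p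
      maximal  : ∀ A → A ∈ₛ p ⊎ (not ∘ A) ∈ₛ p
    open IsFilterₛ isFilter public

  -- A set of `q` outside `p` would have its complement in `p`, hence in `q`.
  ultra-⊒ : ∀ {p q} → IsUltraₛ p → IsFilterₛ q → p ⊑ q → q ⊑ p
  ultra-⊒ {p} {q} up fq p⊑q A A∈q with IsUltraₛ.maximal up A
  ... | inj₁ A∈p  = A∈p
  ... | inj₂ ∁A∈p = contradiction (λ x a ∁a → T-not ∁a a) (IsFilterₛ.disjoint fq A∈q (p⊑q _ ∁A∈p))

infixl 6 _⊙_

_⊙_ : Sub (Sub ℕ⁺) → Sub (Sub ℕ⁺) → Sub (Sub ℕ⁺)
(ℱ ⊙ 𝒢) B = ℱ (λ x → 𝒢 (λ y → B (x +⁺ y)))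

⊙-isFilter : ∀ {ℱ 𝒢} → IsFilterₛ ℱ → IsFilterₛ 𝒢 → IsFilterₛ (ℱ ⊙ 𝒢)
⊙-isFilter f g = record
  { univ   = f.all (λ _ → g.univ)
  ; upward = λ A⊑B → f.upward (λ x → g.upward (λ y → A⊑B (x +⁺ y)))
  ; meet   = f.upward₂ (λ _ → g.meet)
  ; proper = λ ∅∈ → f.proper (f.upward (λ _ → g.proper) ∅∈)
  }
  where
  module f = IsFilterₛ f
  module g = IsFilterₛ g

⊙-isUltra : ∀ {p q} → IsUltraₛ p → IsUltraₛ q → IsUltraₛ (p ⊙ q)
⊙-isUltra {p} {q} up uq = record
  { isFilter = ⊙-isFilter p.isFilter q.isFilter
  ; maximal  = λ A → [ inj₁ , inj₂ ∘ p.upward (complement A) ]′ (p.maximal _)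
  }
  where
  module p = IsUltraₛ up
  module q = IsUltraₛ uq

  complement : ∀ A x → T (not (q (λ y → A (x +⁺ y)))) → T (q (λ y → not (A (x +⁺ y))))
  complement A x A∉ = [ (λ A∈ → contradiction A∈ (T-not A∉)) , id ]′ (q.maximal (λ y → A (x +⁺ y)))

⊙-monoˡ : ∀ {ℱ ℱ′ q} → ℱ ⊑ ℱ′ → ℱ ⊙ q ⊑ ℱ′ ⊙ q
⊙-monoˡ ℱ⊑ℱ′ B = ℱ⊑ℱ′ _

-- The ultrafilter lemma and idempotents in closed subsemigroups.

module Filters (em : ExcludedMiddle 0ℓ) (ac : AxiomOfChoice) where

  open Choice em ac

  filter-chainClosed : ∀ {X} → ChainClosed (IsFilterₛ {X})
  filter-chainClosed {X} I (A₀ , A₀∈I) chain fs = record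
    { univ   = ∈⋃ A₀∈I (IsFilterₛ.univ (fs A₀ A₀∈I))
    ; upward = λ A⊑B A∈ → let ℱ , ℱ∈I , A∈ℱ = ∈⋃⁻ A∈ in
        ∈⋃ ℱ∈I (IsFilterₛ.upward (fs ℱ ℱ∈I) A⊑B A∈ℱ)
    ; meet   = λ A∈ B∈ → meet (∈⋃⁻ A∈) (∈⋃⁻ B∈)
    ; proper = λ ∅∈ → let ℱ , ℱ∈I , ∅∈ℱ = ∈⋃⁻ ∅∈ in IsFilterₛ.proper (fs ℱ ℱ∈I) ∅∈ℱ
    }
    where
    ∈⋃ : ∀ {ℱ A} → ℱ ∈ₛ I → A ∈ₛ ℱ → A ∈ₛ ⋃ I
    ∈⋃ ℱ∈I A∈ℱ = ⟦⟧⁺ (InSome I) (_ , ℱ∈I , A∈ℱ)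

    ∈⋃⁻ : ∀ {A} → A ∈ₛ ⋃ I → InSome I A
    ∈⋃⁻ = ⟦⟧⁻ (InSome I)

    meet : ∀ {A B} → InSome I A → InSome I B → (λ x → A x ∧ B x) ∈ₛ ⋃ I
    meet (ℱ , ℱ∈I , A∈ℱ) (𝒢 , 𝒢∈I , B∈𝒢) with chain ℱ 𝒢 ℱ∈I 𝒢∈I
    ... | inj₁ ℱ⊑𝒢 = ∈⋃ 𝒢∈I (IsFilterₛ.meet (fs 𝒢 𝒢∈I) (ℱ⊑𝒢 _ A∈ℱ) B∈𝒢)
    ... | inj₂ 𝒢⊑ℱ = ∈⋃ ℱ∈I (IsFilterₛ.meet (fs ℱ ℱ∈I) A∈ℱ (𝒢⊑ℱ _ B∈𝒢))

  filter-resp : ∀ {X} {ℱ 𝒢 : Sub (Sub X)} → ℱ ⊑ 𝒢 → 𝒢 ⊑ ℱ → IsFilterₛ ℱ → IsFilterₛ 𝒢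
  filter-resp ℱ⊑𝒢 𝒢⊑ℱ f = record
    { univ   = ℱ⊑𝒢 _ f.univ
    ; upward = λ A⊑B → ℱ⊑𝒢 _ ∘ f.upward A⊑B ∘ 𝒢⊑ℱ _
    ; meet   = λ A∈ B∈ → ℱ⊑𝒢 _ (f.meet (𝒢⊑ℱ _ A∈) (𝒢⊑ℱ _ B∈))
    ; proper = f.proper ∘ 𝒢⊑ℱ _
    }
    where module f = IsFilterₛ f

  -- If the complement of `A` is outside `ℱ`, adjoining `A` to `ℱ` keeps the filter proper, and
  -- maximality then puts `A` into `ℱ`.
  maximal-filter-isUltra : ∀ {X} {ℱ : Sub (Sub X)} → IsFilterₛ ℱ → Maximal IsFilterₛ ℱ → IsUltraₛ ℱ
  maximal-filter-isUltra {X} {ℱ} f max = record { isFilter = f ; maximal = decide }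
    where
    module f = IsFilterₛ f

    adjoin : Sub X → Sub (Sub X)
    adjoin A B = ℱ (λ x → not (A x) ∨ B x)

    decide : ∀ A → A ∈ₛ ℱ ⊎ (not ∘ A) ∈ₛ ℱ
    decide A with em {(not ∘ A) ∈ₛ ℱ}
    ... | yes ∁A∈ = inj₂ ∁A∈
    ... | no  ∁A∉ = inj₁ (max (adjoin A) adjoin-isFilter
                            (λ B → f.upward (λ x b → T-imp⁺ {A x} (λ _ → b)))
                            A (f.all (λ x → T-imp⁺ {A x} id)))
      where
      adjoin-isFilter : IsFilterₛ (adjoin A)
      adjoin-isFilter = record
        { univ   = f.all (λ x → T-imp⁺ {A x} _)
        ; upward = λ B⊑C → f.upward (λ x A→B → T-imp⁺ {A x} (B⊑C x ∘ T-imp⁻ A→B))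
        ; meet   = f.upward₂ (λ x A→B A→C → T-imp⁺ {A x} (λ a → T-∧⁺ (T-imp⁻ A→B a) (T-imp⁻ A→C a)))
        ; proper = λ A→∅∈ → ∁A∉ (f.upward (λ x → ≡.subst T (∨-identityʳ (not (A x)))) A→∅∈)
        }

  ultrafilter-lemma : ∀ {X} {ℱ : Sub (Sub X)} → IsFilterₛ ℱ → ∃ λ q → IsUltraₛ q × ℱ ⊑ q
  ultrafilter-lemma {ℱ = ℱ} f
    with q , fq , ℱ⊑q , max ← Zorn.maximal-exists IsFilterₛ ℱ f filter-chainClosed filter-resp
    = q , maximal-filter-isUltra fq max , ℱ⊑q

  -- The filters whose set of ultrafilter extensions is a closed subsemigroup of βℕ.
  IsAdditive : Sub (Sub ℕ⁺) → Set
  IsAdditive ℱ = IsFilterₛ ℱ × (∀ q → IsUltraₛ q → ℱ ⊑ q → ℱ ⊑ ℱ ⊙ q)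

  additive-chainClosed : ChainClosed IsAdditive
  additive-chainClosed I ne chain as =
    filter-chainClosed I ne chain (λ A A∈I → proj₁ (as A A∈I)) ,
    λ q uq ⋃⊑q B B∈⋃ → let ℱ , ℱ∈I , B∈ℱ = ⟦⟧⁻ (InSome I) B∈⋃ in
      ⟦⟧⁺ (InSome I) (ℱ , ℱ∈I ,
        proj₂ (as ℱ ℱ∈I) q uq (λ A A∈ℱ → ⋃⊑q A (⟦⟧⁺ (InSome I) (ℱ , ℱ∈I , A∈ℱ))) B B∈ℱ)

  additive-resp : ∀ {ℱ 𝒢} → ℱ ⊑ 𝒢 → 𝒢 ⊑ ℱ → IsAdditive ℱ → IsAdditive 𝒢
  additive-resp ℱ⊑𝒢 𝒢⊑ℱ (f , h) =
    filter-resp ℱ⊑𝒢 𝒢⊑ℱ f ,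
    λ q uq 𝒢⊑q B B∈𝒢 → ℱ⊑𝒢 _ (h q uq (λ A A∈ℱ → 𝒢⊑q A (ℱ⊑𝒢 A A∈ℱ)) B (𝒢⊑ℱ B B∈𝒢))

  -- The filter of the closed set { r ⊇ ℱ : r ⊙ p ≈ q }.
  module Fibre {ℱ p q} (f : IsFilterₛ ℱ) (up : IsUltraₛ p) (uq : IsUltraₛ q) (ℱp⊑q : ℱ ⊙ p ⊑ q) where

    private
      module f = IsFilterₛ f
      module p = IsUltraₛ up
      module q = IsUltraₛ uq

    _/p : Sub ℕ⁺ → Sub ℕ⁺
    (B /p) x = p (λ y → B (x +⁺ y))

    -- The filter generated by `ℱ` and all `B /p` with `B` in `q`. One `B` at a time suffices,
    -- because the quotient of an intersection lies in both quotients.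
    Generated : Sub ℕ⁺ → Set
    Generated D = ∃ λ B → B ∈ₛ q × (λ x → not ((B /p) x) ∨ D x) ∈ₛ ℱ

    fibre : Sub (Sub ℕ⁺)
    fibre = ⟦ Generated ⟧

    ℱ⊑fibre : ℱ ⊑ fibre
    ℱ⊑fibre D D∈ℱ = ⟦⟧⁺ Generated (_ , q.univ , f.upward (λ x d → T-imp⁺ {((λ _ → true) /p) x} (λ _ → d)) D∈ℱ)

    /p∈fibre : ∀ B → B ∈ₛ q → (B /p) ∈ₛ fibre
    /p∈fibre B B∈q = ⟦⟧⁺ Generated (B , B∈q , f.all (λ x → T-imp⁺ {(B /p) x} id))

    fibre-isFilter : IsFilterₛ fibre
    fibre-isFilter = record
      { univ   = ℱ⊑fibre _ f.univ
      ; upward = λ D⊑E D∈ → let B , B∈q , B→D = ⟦⟧⁻ Generated D∈ in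
          ⟦⟧⁺ Generated (B , B∈q , f.upward (λ x h → T-imp⁺ {(B /p) x} (D⊑E x ∘ T-imp⁻ h)) B→D)
      ; meet   = λ D∈ E∈ →
          let B , B∈q , B→D = ⟦⟧⁻ Generated D∈
              C , C∈q , C→E = ⟦⟧⁻ Generated E∈
          in ⟦⟧⁺ Generated ((λ x → B x ∧ C x) , q.meet B∈q C∈q ,
            f.upward₂ (λ x h k → T-imp⁺ {((λ x → B x ∧ C x) /p) x} (λ bc →
              T-∧⁺ (T-imp⁻ h (p.upward (λ _ → proj₁ ∘ T-∧⁻) bc))
                   (T-imp⁻ k (p.upward (λ y → proj₂ ∘ T-∧⁻ {B (x +⁺ y)}) bc)))) B→D C→E)
      -- If `B /p` fails for `ℱ`-many points, the complement of `B` is in `ℱ ⊙ p`, hence in `q` next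
      -- to `B`.
      ; proper = λ ∅∈ → let B , B∈q , B→∅ = ⟦⟧⁻ Generated ∅∈ in
          q.disjoint B∈q (ℱp⊑q (not ∘ B) (f.upward (λ x h →
              [ (λ b → contradiction (T-imp⁻ h b) id) , id ]′ (p.maximal (λ y → B (x +⁺ y)))) B→∅))
            (λ x b ∁b → T-not ∁b b)
      }

  -- For a closed subsemigroup S and `p` in S, S + p is again one: `q` in S + p factors as `r ⊙ p`
  -- with `r` in S, and `p ⊙ r` is in S as well, so additivity of `ℱ` applies to `p ⊙ r` and the set
  -- `B /p`.
  additive-⊙ : ∀ {ℱ p} → IsAdditive ℱ → IsUltraₛ p → ℱ ⊑ p → IsAdditive (ℱ ⊙ p)
  additive-⊙ {ℱ} {p} (f , add) up ℱ⊑p =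
    ⊙-isFilter f (IsUltraₛ.isFilter up) , λ q uq ℱp⊑q B B∈ℱp →
      let open Fibre f up uq ℱp⊑q
          r , ur , fibre⊑r = ultrafilter-lemma fibre-isFilter
          ℱ⊑r   = λ A A∈ℱ → fibre⊑r A (ℱ⊑fibre A A∈ℱ)
          q⊑r⊙p = λ A A∈q → fibre⊑r (A /p) (/p∈fibre A A∈q)
          r⊙p⊑q = ultra-⊒ uq (IsUltraₛ.isFilter (⊙-isUltra ur up)) q⊑r⊙p
          ℱ⊑p⊙r = λ A A∈ℱ → ⊙-monoˡ {q = r} ℱ⊑p A (add r ur ℱ⊑r A A∈ℱ)
      in IsFilterₛ.upward f
           (λ x → IsUltraₛ.upward up λ y h → r⊙p⊑q _
             (IsUltraₛ.upward ur (λ z → IsUltraₛ.upward up λ w →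
               ≡.subst (λ u → T (B u)) (reassoc x y z w)) h))
           (add (p ⊙ r) (⊙-isUltra up ur) ℱ⊑p⊙r (B /p) B∈ℱp)
    where
    reassoc : ∀ x y z w → (x +⁺ (y +⁺ z)) +⁺ w ≡ (x +⁺ y) +⁺ (z +⁺ w)
    reassoc x y z w = ≡.trans (≡.cong (_+⁺ w) (≡.sym (+⁺-assoc x y z))) (+⁺-assoc (x +⁺ y) z w)

  -- The fibre over `p` itself represents the ultrafilters `r` in the subsemigroup with r + p = p;
  -- two of them have a sum that also fixes `p`.
  additive-stabilizer : ∀ {ℱ p} → IsAdditive ℱ → (up : IsUltraₛ p) → ℱ ⊑ p → (ℱp⊑p : ℱ ⊙ p ⊑ p) →
                        (f : IsFilterₛ ℱ) → IsAdditive (Fibre.fibre f up up ℱp⊑p)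
  additive-stabilizer {ℱ} {p} (_ , add) up ℱ⊑p ℱp⊑p f =
    fibre-isFilter , λ q uq fibre⊑q D D∈ →
      let B , B∈p , B→D = ⟦⟧⁻ Generated D∈
          module g = IsFilterₛ fibre-isFilter
          ℱ⊑q = λ A A∈ℱ → fibre⊑q A (ℱ⊑fibre A A∈ℱ)
          p⊑q⊙p = λ A A∈p → fibre⊑q (A /p) (/p∈fibre A A∈p)
      in g.upward₂
           (λ x b h → IsUltraₛ.upward₂ uq (λ y → T-imp⁻)
              h (IsUltraₛ.upward uq (λ y → IsUltraₛ.upward up λ z →
                   ≡.subst (λ u → T (B u)) (≡.sym (+⁺-assoc x y z))) (p⊑q⊙p _ b)))
           (/p∈fibre B B∈p)
           (ℱ⊑fibre _ (add q uq ℱ⊑q _ B→D))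
    where open Fibre f up up ℱp⊑p

  -- Ellis's lemma, for the closed subsemigroup given by an additive filter.
  idempotent-exists : ∀ {ℱ} → IsAdditive ℱ → ∃ λ p → IsUltraₛ p × ℱ ⊑ p × p ⊑ p ⊙ p
  idempotent-exists {ℱ} aℱ
    -- A maximal additive filter represents a minimal closed subsemigroup, each of whose members is
    -- idempotent.
    with 𝓜 , a𝓜@(f , add) , ℱ⊑𝓜 , max ← Zorn.maximal-exists IsAdditive ℱ aℱ additive-chainClosed additive-resp
    with p , up , 𝓜⊑p ← ultrafilter-lemma f =
    p , up , (λ A A∈ℱ → 𝓜⊑p A (ℱ⊑𝓜 A A∈ℱ)) ,
    -- By maximality the stabilizer of `p` is the whole subsemigroup, so it contains `p`.
    λ B B∈p → 𝓜⊑p _ (max fibre (additive-stabilizer a𝓜 up 𝓜⊑p 𝓜p⊑p f) ℱ⊑fibre _ (/p∈fibre B B∈p))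
    where
    𝓜p⊑p : 𝓜 ⊙ p ⊑ p
    -- By maximality S + p = S, so `p` itself lies in S + p and its fibre is proper.
    𝓜p⊑p B B∈ = 𝓜⊑p B (max (𝓜 ⊙ p) (additive-⊙ a𝓜 up 𝓜⊑p) (add p up 𝓜⊑p) B B∈)
    open Fibre f up up 𝓜p⊑p

-- The Hales–Jewett theorem

module HalesJewettTheorem where

  open import Data.List.Relation.Unary.Unique.Propositional using (Unique)
  open import Data.Vec using (_++_; lookup; tabulate)

  -- Words over an alphabet extended by a variable, which is coded as nothing.
  VarWord : Set → ℕ → Set
  VarWord A = Vec (Maybe A)

  fill : ∀ {A n} → A → VarWord A n → Vec A n
  fill a = Vec.map (fromMaybe a)

  HasVar : ∀ {A n} → VarWord A n → Set
  HasVar = VecAny.Any (_≡ nothing)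

  Monochromatic : ∀ {A C : Set} {n} → (Vec A n → C) → Set
  Monochromatic {A} {n = n} c = ∃ λ (l : VarWord A n) → HasVar l × (∀ a b → c (fill a l) ≡ c (fill b l))

  HalesJewett : ℕ → ℕ → Set
  HalesJewett k r = ∃ λ n → (c : Vec (Fin k) n → Fin r) → Monochromatic c

  private

    fill-just : ∀ {A : Set} {n} (a : A) (w : Vec A n) → fill a (Vec.map just w) ≡ w
    fill-just a w = trans (sym (Vec.map-∘ (fromMaybe a) just w)) (Vec.map-id w)

    fill-++ : ∀ {A : Set} {m n} (a : A) (l : VarWord A m) (l′ : VarWord A n) →
              fill a (l ++ l′) ≡ fill a l ++ fill a l′
    fill-++ a = Vec.map-++ (fromMaybe a)

    fill-map : ∀ {A B : Set} {n} (f : A → B) (a : A) (l : VarWord A n) →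
               fill (f a) (Vec.map (Maybe.map f) l) ≡ Vec.map f (fill a l)
    fill-map f a []            = refl
    fill-map f a (just x ∷ l)  = cong (f x ∷_) (fill-map f a l)
    fill-map f a (nothing ∷ l) = cong (f a ∷_) (fill-map f a l)

    hasVar-map : ∀ {A B : Set} {n} (f : A → B) {l : VarWord A n} → HasVar l → HasVar (Vec.map (Maybe.map f) l)
    hasVar-map f (here refl) = here refl
    hasVar-map f (there v)   = there (hasVar-map f v)

    encode : ∀ {k n} → Vec (Fin k) n → Fin (k ^ n)
    encode w = funToFin (lookup w)

    decode : ∀ {k n} → Fin (k ^ n) → Vec (Fin k) n
    decode x = tabulate (finToFun x)

    decode-encode : ∀ {k n} (w : Vec (Fin k) n) → decode (encode w) ≡ w
    decode-encode w = trans (Vec.tabulate-cong (finToFun-funToFin (lookup w))) (Vec.tabulate∘lookup w)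

    module Step (k r : ℕ) (hj : ∀ r → HalesJewett (suc k) r) where

      K = suc k

      -- The new letter is zero, the old letters are the successors.
      Focus : ∀ {n} → (Vec (Fin (suc K)) n → Fin r) → Vec (Fin (suc K)) n → Fin r → Set
      Focus {n} c e d = ∃ λ (l : VarWord (Fin (suc K)) n) →
        HasVar l × fill zero l ≡ e × (∀ a → c (fill (suc a) l) ≡ d)

      Focused : ∀ {n} → ℕ → (Vec (Fin (suc K)) n → Fin r) → Set
      Focused s c = ∃ λ e → ∃ λ ds → length ds ≡ s × Unique ds × All (Focus c e) ds

      -- Colour focusing by induction on `s`: a line in a first block, on which the old letters
      -- cannot be told apart by any continuation, is combined with focused lines in a second block.
      focus : ∀ s → ∃ λ n → (c : Vec (Fin (suc K)) n → Fin r) → Monochromatic c ⊎ Focused s c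
      focus zero    = 0 , λ c → inj₂ ([] , [] , refl , [] , [])
      focus (suc s) with focus s
      -- The colour of a first block is the colouring that it induces on all words of length `n`,
      -- whence the number of colours.
      ... | n , find-foci with hj (r ^ (suc K ^ n))
      ... | m , find-line = m ℕ.+ n , result
        where
        result : (c : Vec (Fin (suc K)) (m ℕ.+ n) → Fin r) → Monochromatic c ⊎ Focused (suc s) c
        result c with find-line (λ w → funToFin (λ x → c (Vec.map suc w ++ decode x)))
        ... | l , v , const = go (find-foci c′)
          where
          l⁺ = Vec.map (Maybe.map suc) l

          c′ : Vec (Fin (suc K)) n → Fin r
          c′ u = c (fill (suc zero) l⁺ ++ u)

          prefix-const : ∀ a u → c (fill (suc a) l⁺ ++ u) ≡ c′ u
          prefix-const a u = begin
            c (fill (suc a) l⁺ ++ u)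
              ≡⟨ cong₂ (λ w u → c (w ++ u)) (fill-map suc a l) (sym (decode-encode u)) ⟩
            c (Vec.map suc (fill a l) ++ decode (encode u))
              ≡⟨ finToFun-funToFin _ (encode u) ⟨
            finToFun (colour a) (encode u)
              ≡⟨ cong (λ x → finToFun x (encode u)) (const a zero) ⟩
            finToFun (colour zero) (encode u)
              ≡⟨ finToFun-funToFin _ (encode u) ⟩
            c (Vec.map suc (fill zero l) ++ decode (encode u))
              ≡⟨ cong₂ (λ w u → c (w ++ u)) (sym (fill-map suc zero l)) (decode-encode u) ⟩
            c′ u
              ∎
            where
            open ≡.≡-Reasoning
            colour : Fin K → Fin (r ^ (suc K ^ n))
            colour a = funToFin (λ x → c (Vec.map suc (fill a l) ++ decode x))

          prepend : Monochromatic c′ → Monochromatic c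
          prepend (l′ , v′ , const′) = Vec.map just (fill (suc zero) l⁺) ++ l′ , ++⁺ʳ _ v′ , λ a b →
            trans (filled a) (trans (const′ a b) (sym (filled b)))
            where
            filled : ∀ a → c (fill a (Vec.map just (fill (suc zero) l⁺) ++ l′)) ≡ c′ (fill a l′)
            filled a = cong c (trans (fill-++ a (Vec.map just (fill (suc zero) l⁺)) l′)
                                     (cong (_++ fill a l′) (fill-just a (fill (suc zero) l⁺))))

          go : Monochromatic c′ ⊎ Focused s c′ → Monochromatic c ⊎ Focused (suc s) c
          go (inj₁ mono) = inj₁ (prepend mono)
          go (inj₂ (e , ds , len , uniq , foci)) with All.all? (λ d → ¬? (c′ e Fin.≟ d)) ds
          -- The focus shares its colour with one of the lines through it, so that line is
          -- monochromatic for the new letter too.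
          ... | no ¬fresh = inj₁ (prepend (mono (find
            (Any.map (λ {d} → decidable-stable (c′ e Fin.≟ d)) (AllP.¬All⇒Any¬ (λ d → ¬? (c′ e Fin.≟ d)) ds ¬fresh)))))
            where
            mono : (∃ λ d → d ∈ₗ ds × c′ e ≡ d) → Monochromatic c′
            mono (d , d∈ds , refl) with All.lookup foci d∈ds
            ... | l′ , v′ , refl , const′ = l′ , v′ , λ a b → trans (same a) (sym (same b))
              where
              same : ∀ a → c′ (fill a l′) ≡ d
              same zero    = refl
              same (suc a) = const′ a
          -- A fresh colour gives one more focused line, which varies in the first block only; the
          -- old lines now vary in both blocks.
          ... | yes fresh = inj₂
            (fill zero l⁺ ++ e , c′ e ∷ ds , cong suc len , fresh ∷ uniq , new ∷ All.map widen foci)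
            where
            new : Focus c (fill zero l⁺ ++ e) (c′ e)
            new = l⁺ ++ Vec.map just e , ++⁺ˡ (hasVar-map suc v) , filled zero ,
              λ a → trans (cong c (filled (suc a))) (prefix-const a e)
              where
              filled : ∀ a → fill a (l⁺ ++ Vec.map just e) ≡ fill a l⁺ ++ e
              filled a = trans (fill-++ a l⁺ (Vec.map just e)) (cong (fill a l⁺ ++_) (fill-just a e))

            widen : ∀ {d} → Focus c′ e d → Focus c (fill zero l⁺ ++ e) d
            widen (l′ , v′ , refl , const′) = l⁺ ++ l′ , ++⁺ˡ (hasVar-map suc v) , fill-++ zero l⁺ l′ ,
              λ a → trans (cong c (fill-++ (suc a) l⁺ l′)) (trans (prefix-const a (fill (suc a) l′)) (const′ a))

      -- Lines of `suc r` distinct colours cannot exist, so the other alternative of `focus` occurs.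
      step : HalesJewett (suc K) r
      step with focus (suc r)
      ... | n , find-foci = n , λ c → conclude c (find-foci c)
        where
        conclude : ∀ c → Monochromatic c ⊎ Focused (suc r) c → Monochromatic c
        conclude c (inj₁ mono) = mono
        conclude c (inj₂ (_ , ds , len , uniq , _)) =
          contradiction (subst (_≤ r) len (injective⇒≤ (unique-lookup (≡.setoid _) uniq))) (ℕ.<-irrefl refl)

  -- Induction on the alphabet for all numbers of colours at once, since `focus` calls the smaller
  -- alphabet with many more colours.
  hales-jewett : ∀ k r → HalesJewett (suc k) r
  hales-jewett zero    r = 1 , λ c → nothing ∷ [] , here refl , λ { zero zero → refl }
  hales-jewett (suc k) r = Step.step k r (hales-jewett k)

open HalesJewettTheorem

-- Nonempty finite subsets

module _ {S : Setoid 0ℓ 0ℓ} where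

  size : 𝒫f S → ℕ
  size F = List⁺.length (elements F)

  ⊊-trans : ∀ {F G K : 𝒫f S} → F ⊊ G → G ⊊ K → F ⊊ K
  ⊊-trans (F⊆G , _) (G⊆K , K⊈G) = G⊆K ∘ F⊆G , λ K⊆F → K⊈G (F⊆G ∘ K⊆F)

  ⊊-respʳ : ∀ {F G G′ : 𝒫f S} → G ≈ᶠ G′ → F ⊊ G → F ⊊ G′
  ⊊-respʳ (G⊆G′ , G′⊆G) (F⊆G , G⊈F) = G⊆G′ ∘ F⊆G , λ G′⊆F → G⊈F (G′⊆F ∘ G⊆G′)

-- The closure properties common to the sets of `p` and the eventually true predicates on ℕ, so that
-- finite conjunctions are treated once.
record IsMeetClosed {X : Set} (𝓕 : Pred (Pred X 0ℓ) 0ℓ) : Set₁ where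
  field
    univ   : 𝓕 U
    upward : ∀ {A B} → A ⊆ B → 𝓕 A → 𝓕 B
    meet   : ∀ {A B} → 𝓕 A → 𝓕 B → 𝓕 (A ∩ B)

  all-list : ∀ {I : Set} (is : List I) (Q : I → Pred X 0ℓ) →
             (∀ i → i ∈ₗ is → 𝓕 (Q i)) → 𝓕 (λ x → ∀ i → i ∈ₗ is → Q i x)
  all-list []       Q h = upward (λ _ i ()) univ
  all-list (i ∷ is) Q h =
    upward (λ { (q , qs) _ (here refl) → q ; (q , qs) j (there j∈) → qs j j∈ })
      (meet (h i (here refl)) (all-list is Q (λ j → h j ∘ there)))

  all-∈ᶠ : ∀ {S : Setoid 0ℓ 0ℓ} (F : 𝒫f S) (Q : Setoid.Carrier S → Pred X 0ℓ) →
           (∀ {s t} → Setoid._≈_ S s t → Q s ⊆ Q t) →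
           (∀ s → s ∈ᶠ F → 𝓕 (Q s)) → 𝓕 (λ x → ∀ s → s ∈ᶠ F → Q s x)
  all-∈ᶠ {S} F Q resp h =
    upward (λ qs s s∈F → let t , t∈F , s≈t = Membership.find (≡.setoid _) s∈F
                         in resp (Setoid.sym S s≈t) (qs t t∈F))
      (all-list (List⁺.toList (elements F)) Q
        (λ s s∈F → h s (Any.map (Setoid.reflexive S) s∈F)))

eventually-isMeetClosed : IsMeetClosed (λ (A : Pred ℕ 0ℓ) → ∃ λ N → ∀ n → N ≤ n → A n)
eventually-isMeetClosed = record
  { univ   = 0 , _
  ; upward = λ A⊆B (N , h) → N , λ n N≤n → A⊆B (h n N≤n)
  ; meet   = λ (M , g) (N , h) → M ℕ.⊔ N , λ n M⊔N≤n →
      g n (ℕ.m⊔n≤o⇒m≤o M N M⊔N≤n) , h n (ℕ.m⊔n≤o⇒n≤o M N M⊔N≤n)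
  }

sublists : ∀ {A : Set} → List A → List (List A)
sublists []       = [] ∷ []
sublists (x ∷ xs) = List.map (x ∷_) (sublists xs) List.++ sublists xs

filter∈sublists : ∀ {A : Set} {P : Pred A 0ℓ} (P? : ∀ x → Dec (P x)) xs → filter P? xs ∈ₗ sublists xs
filter∈sublists P? []       = here refl
filter∈sublists P? (x ∷ xs) with P? x
... | yes _ = ∈-++⁺ˡ (∈-map⁺ (x ∷_) (filter∈sublists P? xs))
... | no  _ = ∈-++⁺ʳ _ (filter∈sublists P? xs)

module Finite (em : ExcludedMiddle 0ℓ) where

  module _ {S : Setoid 0ℓ 0ℓ} where

    open Setoid S using (Carrier; _≈_)
    open Membership S using (_∈_; _∉_)

    decSetoid : DecSetoid 0ℓ 0ℓ
    decSetoid = record { isDecEquivalence = record { isEquivalence = Setoid.isEquivalence S ; _≟_ = λ _ _ → em } }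

    fromList⁺ : List⁺ Carrier → 𝒫f S
    fromList⁺ (x ∷ xs) = record
      -- This is `deduplicate` of the whole list unfolded once, which exhibits its head.
      { elements = x ∷ filter _ (deduplicate (DecSetoid._≟_ decSetoid) xs)
      ; unique   = UniqueDec.deduplicate-! decSetoid (x ∷ xs)
      }

    ∈-fromList⁺⁺ : ∀ {s} xs → s ∈ List⁺.toList xs → s ∈ᶠ fromList⁺ xs
    ∈-fromList⁺⁺ (x ∷ xs) = Mem.∈-deduplicate⁺ S (DecSetoid._≟_ decSetoid)
      (λ s≈t s≈r → Setoid.trans S s≈r (Setoid.sym S s≈t))

    -- A point of `F` outside `G`, put in front of the enumeration of `G`, leaves a repetition-free
    -- list inside `F`.
    ⊊⇒size< : ∀ {G F : 𝒫f S} → G ⊊ F → size G < size F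
    ⊊⇒size< {G} {F} (G⊆F , F⊈G) with em {∃ λ s → s ∈ᶠ F × ¬ s ∈ᶠ G}
    ... | yes (s , s∈F , s∉G) =
      unique-⊆⇒length≤ S (Mem.∉⇒All[≉] S s∉G ∷ unique G)
        λ { (here t≈s) → Mem.∈-resp-≈ S (Setoid.sym S t≈s) s∈F ; (there t∈G) → G⊆F t∈G }
    ... | no none = contradiction (λ {s} → F⊆G {s}) F⊈G
      where
      F⊆G : ∀ {s} → s ∈ᶠ F → s ∈ᶠ G
      F⊆G {s} s∈F with em {s ∈ᶠ G}
      ... | yes s∈G = s∈G
      ... | no  s∉G = contradiction (s , s∈F , s∉G) none

    infixr 6 _∪_

    _∪_ : 𝒫f S → 𝒫f S → 𝒫f S
    F ∪ G = fromList⁺ (elements F List⁺.⁺++⁺ elements G)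

    ⊆-∪ˡ : ∀ F G {s} → s ∈ᶠ F → s ∈ᶠ F ∪ G
    ⊆-∪ˡ F G s∈F = ∈-fromList⁺⁺ (elements F List⁺.⁺++⁺ elements G) (Mem.∈-++⁺ˡ S s∈F)

    ⊆-∪ʳ : ∀ F G {s} → s ∈ᶠ G → s ∈ᶠ F ∪ G
    ⊆-∪ʳ F G s∈G = ∈-fromList⁺⁺ (elements F List⁺.⁺++⁺ elements G) (Mem.∈-++⁺ʳ S (List⁺.toList (elements F)) s∈G)

    -- Each `G` below `F` has the same members as a sublist of the enumeration of `F`. There are
    -- finitely many sublists, and `Q` depends on the members alone.
    all-⊊ : ∀ {X : Set} {𝓕 : Pred (Pred X 0ℓ) 0ℓ} → IsMeetClosed 𝓕 →
            (F : 𝒫f S) (Q : 𝒫f S → Pred X 0ℓ) → (∀ {G G′} → G ≈ᶠ G′ → Q G ⊆ Q G′) →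
            (∀ G → G ⊊ F → 𝓕 (Q G)) → 𝓕 (λ x → ∀ G → G ⊊ F → Q G x)
    all-⊊ {X} {𝓕} mc F Q resp h =
      upward (λ {x} qs G G⊊F → qs _ (filter∈sublists (λ s → em {s ∈ᶠ G}) xs) G (trace G G⊊F) G⊊F)
        (all-list (sublists xs) Z (λ gs _ → Z∈ gs))
      where
      open IsMeetClosed mc
      xs = List⁺.toList (elements F)

      Lists : List Carrier → 𝒫f S → Set
      Lists gs G = (_∈ᶠ G) ≐ (_∈ gs)

      Z : List Carrier → Pred X 0ℓ
      Z gs x = ∀ G → Lists gs G → G ⊊ F → Q G x

      Z∈ : ∀ gs → 𝓕 (Z gs)
      Z∈ gs with em {∃ λ G → Lists gs G × G ⊊ F}
      ... | yes (G , (G⊆ , ⊆G) , G⊊F) = upward (λ q G′ (G′⊆ , ⊆G′) _ → resp (⊆G′ ∘ G⊆ , ⊆G ∘ G′⊆) q) (h G G⊊F)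
      ... | no none = upward (λ _ G l G⊊F → contradiction (G , l , G⊊F) none) univ

      trace : ∀ G → G ⊊ F → Lists (filter (λ s → em {s ∈ᶠ G}) xs) G
      trace G (G⊆F , _) =
        (λ s∈G → Mem.∈-filter⁺ S (λ s → em {s ∈ᶠ G}) (Mem.∈-resp-≈ S) (G⊆F s∈G) s∈G) ,
        (λ s∈ → proj₂ (Mem.∈-filter⁻ S (λ s → em {s ∈ᶠ G}) (Mem.∈-resp-≈ S) s∈))

val-∑ : ∀ β f → val (∑ β f) ≡ sum (List.map (val ∘ f) (List⁺.toList (elements β)))
val-∑ β f = go (List⁺.head (elements β)) (List⁺.tail (elements β))
  where
  go : ∀ x xs → val (foldr₁ _+⁺_ (List⁺.map f (x ∷ xs))) ≡ sum (List.map (val ∘ f) (x ∷ xs))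
  go x []       = sym (ℕ.+-identityʳ _)
  go x (y ∷ xs) = cong (val (f x) ℕ.+_) (go y xs)

module _ (β : 𝒫f ℕ⁺-setoid) where

  ≤-maxᶠ : ∀ {t} → t ∈ᶠ β → val t ≤ val (maxᶠ β)
  ≤-maxᶠ (here refl) = Extrema.f[⊥]≤f[argmax] {f = val} (List⁺.head (elements β)) (List⁺.tail (elements β))
  ≤-maxᶠ (there t∈)  = All.lookup (Extrema.f[xs]≤f[argmax] (List⁺.head (elements β)) _) t∈

  minᶠ-≤ : ∀ {t} → t ∈ᶠ β → val (minᶠ β) ≤ val t
  minᶠ-≤ (here refl) = Extrema.f[argmin]≤f[⊤] {f = val} (List⁺.head (elements β)) (List⁺.tail (elements β))
  minᶠ-≤ (there t∈)  = All.lookup (Extrema.f[argmin]≤f[xs] (List⁺.head (elements β)) _) t∈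

  maxᶠ-≤ : ∀ {n} → (∀ t → t ∈ᶠ β → val t ≤ n) → val (maxᶠ β) ≤ n
  maxᶠ-≤ h = Extrema.f[argmax]≤v⁺ (h _ (here refl)) (All.tabulate (λ t∈ → h _ (there t∈)))

  <-minᶠ : ∀ {n} → (∀ t → t ∈ᶠ β → n < val t) → n < val (minᶠ β)
  <-minᶠ h = Extrema.v<f[argmin]⁺ (h _ (here refl)) (All.tabulate (λ t∈ → h _ (there t∈)))

-- Tensor powers

module Tensor (p : βℕ) where

  private module p = Ultrafilter p

  -- `⨂` splits off the last coordinate while trees grow from the first. Unfolding shows the two
  -- conditions to be the same type.
  ⨂-cons : ∀ k (A : Pred (Vec ℕ⁺ (suc (suc k))) 0ℓ) →
           (⨂ {suc k} (λ _ → p) ∋ A) ≡ (p ∋ λ x → ⨂ {k} (λ _ → p) ∋ λ xs → A (x ∷ xs))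
  ⨂-cons zero    A = refl
  ⨂-cons (suc k) A = ⨂-cons k (λ xs → p ∋ λ y → A (xs Vec.∷ʳ y))

  -- Prefixes are listed with the newest entry first.
  record Tree (k : ℕ) (A : Pred (Vec ℕ⁺ (suc k)) 0ℓ) : Set₁ where
    field
      D      : Pred (List ℕ⁺) 0ℓ
      root   : D []
      branch : ∀ xs → D xs → p ∋ λ y → D (y ∷ xs)
      leaf   : ∀ ys → D (toList ys ʳ++ []) → A ys

  tree⇒⨂ : ∀ {k A} → Tree k A → ⨂ {k} (λ _ → p) ∋ A
  tree⇒⨂ {k} t = go k root _ leaf
    where
    open Tree t
    go : ∀ k {xs} → D xs → (A : Pred (Vec ℕ⁺ (suc k)) 0ℓ) →
         (∀ ys → D (toList ys ʳ++ xs) → A ys) → ⨂ {k} (λ _ → p) ∋ A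
    go zero    d A h = p.upward (λ {y} → h (y ∷ [])) (branch _ d)
    go (suc k) d A h = subst id (sym (⨂-cons k A))
      (p.upward (λ {x} d′ → go k d′ (A ∘ (x ∷_)) (h ∘ (x ∷_))) (branch _ d))

  -- The section of `A` over a prefix, oldest entry first, belongs to the tensor power of the
  -- remaining coordinates. Overlong prefixes are unconstrained, so every node branches.
  Prefix : ∀ n → Pred (Vec ℕ⁺ n) 0ℓ → List ℕ⁺ → Set
  Prefix zero    A []       = A []
  Prefix zero    A (_ ∷ _)  = ⊤
  Prefix (suc k) A []       = ⨂ {k} (λ _ → p) ∋ A
  Prefix (suc n) A (x ∷ xs) = Prefix n (A ∘ (x ∷_)) xs

  prefix-branch : ∀ n A xs → Prefix n A xs → p ∋ λ y → Prefix n A (xs List.++ y ∷ [])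
  prefix-branch zero          A []       h = p.upward _ p.univ
  prefix-branch zero          A (x ∷ xs) h = p.upward _ p.univ
  prefix-branch (suc zero)    A []       h = h
  prefix-branch (suc (suc k)) A []       h = subst id (⨂-cons k A) h
  prefix-branch (suc n)       A (x ∷ xs) h = prefix-branch n (A ∘ (x ∷_)) xs h

  prefix-leaf : ∀ n A (ys : Vec ℕ⁺ n) → Prefix n A (toList ys) → A ys
  prefix-leaf zero    A []       h = h
  prefix-leaf (suc n) A (y ∷ ys) h = prefix-leaf n (A ∘ (y ∷_)) ys h

  ⨂⇒tree : ∀ {k A} → ⨂ {k} (λ _ → p) ∋ A → Tree k A
  ⨂⇒tree {k} {A} h = record
    { D      = Prefix (suc k) A ∘ reverse
    ; root   = h
    ; branch = λ xs d → p.upward (λ {y} → subst (Prefix (suc k) A) (sym (unfold-reverse y xs)))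
                          (prefix-branch (suc k) A (reverse xs) d)
    ; leaf   = λ ys → prefix-leaf (suc k) A ys ∘ subst (Prefix (suc k) A) (reverse-involutive (toList ys))
    }

-- Block sums along chains

𝔽 : Set
𝔽 = 𝒫f ℕ⁺^ℕ⁺

𝔹 : Set
𝔹 = 𝒫f ℕ⁺-setoid

val>0 : ∀ t → 0 < val t
val>0 (mkℕ⁺ n) = >-nonZero⁻¹ n

∑-cong : ∀ β {f g} → (∀ t → t ∈ᶠ β → f t ≡ g t) → ∑ β f ≡ ∑ β g
∑-cong β {f} {g} f≡g = val-injective (trans (val-∑ β f)
  (trans (cong sum (map-cong-local (All.tabulate (λ t∈ → cong val (f≡g _ t∈))))) (sym (val-∑ β g))))

Chain : ℕ → (ℕ⁺ → 𝔽) → Set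
Chain n G = ∀ i → val i < n → G i ⊊ G (suc⁺ i)

chain-⊊ : ∀ {n G} → Chain n G → ∀ {i j} → val i < val j → val j ≤ n → G i ⊊ G j
chain-⊊ {n} {G} chain {i} {mkℕ⁺ j} = go j
  where
  go : ∀ j .{{_ : NonZero j}} → val i < j → j ≤ n → G i ⊊ G (mkℕ⁺ j)
  go (suc j) (s≤s i≤j) j<n with ℕ.m≤n⇒m<n∨m≡n i≤j
  ... | inj₂ refl = chain i j<n
  ... | inj₁ i<j  = ⊊-trans {F = G i} {G j⁺} {G (suc⁺ j⁺)} (go j (i<j) (ℕ.<⇒≤ j<n)) (chain j⁺ j<n)
    where
    instance _ = >-nonZero (ℕ.≤-<-trans z≤n i<j)
    j⁺ = mkℕ⁺ j

module _ (c : 𝔽 → ℕ⁺ × 𝔹) where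

  term : 𝔽 → (ℕ⁺ → ℕ⁺) → ℕ⁺
  term G f = proj₁ (c G) +⁺ (∑[ t ∈ proj₂ (c G) ] f t)

  -- State G x xs: along some chain ending in G the blocks summed so far give xs,
  -- newest first, and x, where the block of x is still open and includes G.
  data State : 𝔽 → ℕ⁺ → List ℕ⁺ → Set where
    start : ∀ {G f} → f ∈ᶠ G → State G (term G f) []
    new   : ∀ {G G′ x xs f} → G′ ⊊ G → State G′ x xs → f ∈ᶠ G → State G (term G f) (x ∷ xs)
    add   : ∀ {G G′ x xs f} → G′ ⊊ G → State G′ x xs → f ∈ᶠ G → State G (x +⁺ term G f) xs

  -- Clause (b) of the first statement, with α and H packed into `c`.
  Conclusion : (m : ℕ) → Pred (Vec ℕ⁺ (suc m)) 0ℓ → Set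
  Conclusion k A = let m = suc k in
    ∀ (n : ℕ) → m ≤ n →
    (G : ℕ⁺ → 𝔽) → (∀ i → val i < n → G i ⊊ G (suc⁺ i)) →
    (β : Vec 𝔹 m) → Linked _<ᶠ_ β → val (maxᶠ (last β)) ≤ n →
    (f : ℕ⁺ → ℕ⁺ → ℕ⁺) → (∀ i → val i ≤ n → f i ∈ᶠ G i) →
    A (Vec.map (λ βⱼ → ∑[ i ∈ βⱼ ] (proj₁ (c (G i)) +⁺ (∑[ t ∈ proj₂ (c (G i)) ] f i t))) β)

  module Run {n : ℕ} {G : ℕ⁺ → 𝔽} (chain : Chain n G)
             {f : ℕ⁺ → ℕ⁺ → ℕ⁺} (f∈ : ∀ i → val i ≤ n → f i ∈ᶠ G i) where

    u : ℕ⁺ → ℕ⁺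
    u i = term (G i) (f i)

    -- The invariant while indices are processed in increasing order: the last index used is at most
    -- `b`. Before the first block there is no state yet.
    data Reached (b : ℕ) : List ℕ⁺ → Set where
      none : Reached b []
      some : ∀ {i x xs} → val i ≤ b → State (G i) x xs → Reached b (x ∷ xs)

    open Sort (On.decTotalOrder ≤-decTotalOrder val) using (sort; sort-↭; sort-↗)

    run-list : ∀ {b i x xs} ts → AllPairs (λ s t → val s < val t) (i ∷ ts) → b ≤ n →
               All (λ t → val t ≤ b) (i ∷ ts) → State (G i) x xs →
               ∃ λ y → Reached b (y ∷ xs) × val y ≡ val x ℕ.+ sum (List.map (val ∘ u) ts)
    run-list []       _ _ (i≤b ∷ _) s = _ , some i≤b s , sym (ℕ.+-identityʳ _)
    run-list {i = i} {x} (t ∷ ts) ((i<t ∷ _) ∷ asc) b≤n (_ ∷ t≤b ∷ ≤b) s =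
      let t≤n = ℕ.≤-trans t≤b b≤n
          y , r , eq = run-list ts asc b≤n (t≤b ∷ ≤b)
            (add {G = G t} {G i} (chain-⊊ {n} {G} chain {i} {t} i<t t≤n) s (f∈ t t≤n))
      in y , r , trans eq (ℕ.+-assoc (val x) (val (u t)) _)

    -- A block may be enumerated in any order, but a state climbs the chain; the block is therefore
    -- sorted, which leaves its sum unchanged.
    run-block : ∀ {b acc} β → b < val (minᶠ β) → val (maxᶠ β) ≤ n → Reached b acc →
                Reached (val (maxᶠ β)) (∑ β u ∷ acc)
    run-block {b} {acc} β b<β β≤n r = go (sort es) (sort-↭ es) ascending r
      where
      es = List⁺.toList (elements β)

      ascending : AllPairs (λ s t → val s < val t) (sort es)
      ascending = AllPairs.zipWith (λ (s≤t , s≢t) → ℕ.≤∧≢⇒< s≤t (s≢t ∘ val-injective))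
        ( Linked⇒AllPairs (λ {x y z} → ℕ.≤-trans {val x} {val y} {val z}) (sort-↗ es)
        , Unique-resp-↭ ℕ⁺-setoid (↭⇒↭ₛ (↭-sym (sort-↭ es))) (unique β))

      go : ∀ ts → ts ↭ es → AllPairs (λ s t → val s < val t) ts → Reached b acc →
           Reached (val (maxᶠ β)) (∑ β u ∷ acc)
      go [] perm _ _ with () ← ∈-resp-↭ (↭-sym perm) (here refl)
      go (t ∷ ts) perm asc r = finish (first r)
        where
        t∈β = ∈-resp-↭ perm (here refl)
        t≤n = ℕ.≤-trans (≤-maxᶠ β t∈β) β≤n
        b<t = ℕ.<-≤-trans b<β (minᶠ-≤ β t∈β)

        first : Reached b acc → State (G t) (u t) acc
        first none             = start (f∈ t t≤n)
        first (some {i} i≤b s) =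
          new {G = G t} {G i} (chain-⊊ {n} {G} chain {i} {t} (ℕ.≤-<-trans i≤b b<t) t≤n) s (f∈ t t≤n)

        finish : State (G t) (u t) acc → Reached (val (maxᶠ β)) (∑ β u ∷ acc)
        finish s with run-list ts asc β≤n (All.tabulate (λ t∈ → ≤-maxᶠ β (∈-resp-↭ perm t∈))) s
        ... | y , r , eq = subst (λ z → Reached _ (z ∷ acc)) (val-injective (begin
          val y                         ≡⟨ eq ⟩
          sum (List.map (val ∘ u) (t ∷ ts)) ≡⟨ sum-↭ (map⁺ (val ∘ u) perm) ⟩
          sum (List.map (val ∘ u) es)   ≡⟨ val-∑ β u ⟨
          val (∑ β u)                   ∎)) r
          where open ≡.≡-Reasoning

    head≤ : ∀ {j} (βs : Vec 𝔹 (suc j)) → Linked _<ᶠ_ βs → val (maxᶠ (last βs)) ≤ n → val (maxᶠ (Vec.head βs)) ≤ n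
    head≤ (β ∷ [])          _       ≤n = ≤n
    head≤ (β ∷ βs@(γ ∷ _)) (β<γ ∷ l) ≤n =
      ℕ.≤-trans (ℕ.<⇒≤ β<γ) (ℕ.≤-trans (minᶠ-≤ γ (here refl)) (ℕ.≤-trans (≤-maxᶠ γ (here refl)) (head≤ βs l ≤n)))

    run-blocks : ∀ {j b acc} (βs : Vec 𝔹 (suc j)) → Linked _<ᶠ_ βs → val (maxᶠ (last βs)) ≤ n →
                 b < val (minᶠ (Vec.head βs)) → Reached b acc →
                 ∃ λ i → ∃ λ x → ∃ λ xs → State (G i) x xs ×
                   toList (Vec.map (λ β → ∑ β u) βs) ʳ++ acc ≡ x ∷ xs
    run-blocks (β ∷ []) l ≤n b< r with run-block β b< ≤n r
    ... | some _ s = _ , _ , _ , s , refl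
    run-blocks (β ∷ βs@(γ ∷ _)) l@(β<γ ∷ l′) ≤n b< r =
      run-blocks βs l′ ≤n β<γ (run-block β b< (head≤ (β ∷ βs) l ≤n) r)

    run : ∀ {k} (βs : Vec 𝔹 (suc k)) → Linked _<ᶠ_ βs → val (maxᶠ (last βs)) ≤ n →
          ∃ λ i → ∃ λ x → ∃ λ xs → State (G i) x xs ×
            toList (Vec.map (λ β → ∑ β u) βs) ʳ++ [] ≡ x ∷ xs
    run βs l ≤n = run-blocks βs l ≤n (<-minᶠ (Vec.head βs) (λ t _ → val>0 t)) none

-- Realizing states by chains of sets and blocks of indices.

extendAt : ∀ {X : Set} → ℕ⁺ → X → (ℕ⁺ → X) → ℕ⁺ → X
extendAt n x g i with val i ℕ.≤? val n
... | yes _ = g i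
... | no  _ = x

extendAt-≤ : ∀ {X : Set} {n} {x : X} {g i} → val i ≤ val n → extendAt n x g i ≡ g i
extendAt-≤ {n = n} {i = i} i≤n with val i ℕ.≤? val n
... | yes _ = refl
... | no i≰n = contradiction i≤n i≰n

extendAt-> : ∀ {X : Set} {n} {x : X} {g i} → val n < val i → extendAt n x g i ≡ x
extendAt-> {n = n} {i = i} n<i with val i ℕ.≤? val n
... | yes i≤n = contradiction i≤n (ℕ.<⇒≱ n<i)
... | no _ = refl

singleton : ℕ⁺ → 𝔹
singleton n = record { elements = n ∷ [] ; unique = [] ∷ [] }

insert : (n : ℕ⁺) (β : 𝔹) → (∀ t → t ∈ᶠ β → val t < val n) → 𝔹
insert n β β<n = record
  { elements = n List⁺.∷⁺ elements β
  ; unique   = All.tabulate (λ t∈β n≡t → ℕ.<⇒≢ (β<n _ t∈β) (cong val (sym n≡t))) ∷ unique β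
  }

linked-dropʳ : ∀ {X : Set} {R : X → X → Set} xs {ys} →
               LinkedL.Linked R (xs ʳ++ ys) → LinkedL.Linked R ys
linked-dropʳ []       l = l
linked-dropʳ (x ∷ xs) l = LinkedL.tail (linked-dropʳ xs l)

linked-ʳ++⁻ : ∀ {X : Set} {R : X → X → Set} {n} (xs : Vec X n) {ys} →
              LinkedL.Linked (flip R) (toList xs ʳ++ ys) → Linked R xs
linked-ʳ++⁻ []           l = []
linked-ʳ++⁻ (x ∷ [])     l = [-]
linked-ʳ++⁻ (x ∷ x′ ∷ xs) l = LinkedL.head (linked-dropʳ (toList xs) l) ∷ linked-ʳ++⁻ (x′ ∷ xs) l

last-ʳ++ : ∀ {X : Set} {P : X → Set} {n} (xs : Vec X (suc n)) {ys} → All P (toList xs ʳ++ ys) → P (last xs)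
last-ʳ++ (x ∷ [])     (px ∷ _) = px
last-ʳ++ (x ∷ x′ ∷ xs) ps      = last-ʳ++ (x′ ∷ xs) ps

unmap-ʳ++ : ∀ {X Y : Set} (g : X → Y) {n} (ys : Vec Y n) {acc} xs → List.map g xs ≡ toList ys ʳ++ acc →
            ∃ λ (zs : Vec X n) → ∃ λ ws → xs ≡ toList zs ʳ++ ws × Vec.map g zs ≡ ys × List.map g ws ≡ acc
unmap-ʳ++ g []       xs eq = [] , xs , refl , refl , eq
unmap-ʳ++ g (y ∷ ys) xs eq with unmap-ʳ++ g ys xs eq
... | zs , w ∷ ws , refl , refl , refl = w ∷ zs , ws , refl , refl , refl

module _ (c : 𝔽 → ℕ⁺ × 𝔹) where

  -- Data as in clause (b) whose block sums are `xs`, for a chain ending in `K`. Blocks are listed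
  -- newest first, and `short` supplies the inequality between the length of the chain and the
  -- number of blocks.
  record Realization (K : 𝔽) (xs : List ℕ⁺) : Set where
    field
      n       : ℕ⁺
      G       : ℕ⁺ → 𝔽
      chain   : Chain (val n) G
      end     : G n ≡ K
      f       : ℕ⁺ → ℕ⁺ → ℕ⁺
      f∈      : ∀ i → val i ≤ val n → f i ∈ᶠ G i
      blocks  : List 𝔹
      linked  : LinkedL.Linked (flip _<ᶠ_) blocks
      bounded : All (λ β → val (maxᶠ β) ≤ val n) blocks
      short   : length blocks ≤ val n
      sums    : List.map (λ β → ∑[ i ∈ β ] term c (G i) (f i)) blocks ≡ xs

  module _ {K K′ : 𝔽} {xs} (r : Realization K xs) (K⊊K′ : K ⊊ K′) {g} (g∈K′ : g ∈ᶠ K′) where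

    open Realization r

    private
      n⁺ = suc⁺ n
      G⁺ = extendAt n K′ G
      f⁺ = extendAt n g f
      sum⁺ = λ β → ∑[ i ∈ β ] term c (G⁺ i) (f⁺ i)

      end⁺ : G⁺ n⁺ ≡ K′
      end⁺ = extendAt-> {g = G} {i = n⁺} (ℕ.n<1+n (val n))

      term⁺ : term c (G⁺ n⁺) (f⁺ n⁺) ≡ term c K′ g
      term⁺ = cong₂ (term c) end⁺ (extendAt-> {g = f} {i = n⁺} (ℕ.n<1+n (val n)))

      chain⁺ : Chain (suc (val n)) G⁺
      chain⁺ i (s≤s i≤n) with ℕ.m≤n⇒m<n∨m≡n i≤n
      ... | inj₁ i<n = ≡.subst₂ _⊊_
        (sym (extendAt-≤ {g = G} {i = i} i≤n)) (sym (extendAt-≤ {g = G} {i = suc⁺ i} i<n)) (chain i i<n)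
      ... | inj₂ i≡n with refl ← val-injective {i} {n} i≡n =
        ≡.subst₂ _⊊_ (sym (trans (extendAt-≤ {g = G} {i = i} i≤n) end)) (sym end⁺) K⊊K′

      f∈⁺ : ∀ i → val i ≤ suc (val n) → f⁺ i ∈ᶠ G⁺ i
      f∈⁺ i i≤n⁺ with ℕ.m≤n⇒m<n∨m≡n i≤n⁺
      ... | inj₁ (s≤s i≤n) = ≡.subst₂ _∈ᶠ_
        (sym (extendAt-≤ {g = f} {i = i} i≤n)) (sym (extendAt-≤ {g = G} {i = i} i≤n)) (f∈ i i≤n)
      ... | inj₂ i≡n⁺ with refl ← val-injective {i} {n⁺} i≡n⁺ =
        ≡.subst₂ _∈ᶠ_ (sym (extendAt-> {g = f} {i = i} (ℕ.n<1+n (val n)))) (sym end⁺) g∈K′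

      sum⁺-≡ : ∀ {β} → val (maxᶠ β) ≤ val n → sum⁺ β ≡ (∑[ i ∈ β ] term c (G i) (f i))
      sum⁺-≡ {β} β≤n = ∑-cong β λ i i∈β →
        let i≤n = ℕ.≤-trans (≤-maxᶠ β i∈β) β≤n
        in cong₂ (term c) (extendAt-≤ {g = G} {i = i} i≤n) (extendAt-≤ {g = f} {i = i} i≤n)

      sums⁺ : ∀ {βs} → All (λ β → val (maxᶠ β) ≤ val n) βs →
              List.map sum⁺ βs ≡ List.map (λ β → ∑[ i ∈ β ] term c (G i) (f i)) βs
      sums⁺ bs = map-cong-local (All.map (λ {β} → sum⁺-≡ {β}) bs)

      weaken : ∀ {βs : List 𝔹} → All (λ β → val (maxᶠ β) ≤ val n) βs → All (λ β → val (maxᶠ β) ≤ val n⁺) βs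
      weaken = All.map ℕ.m≤n⇒m≤1+n

      cons : ∀ {β γs} → All (λ γ → γ <ᶠ β) γs → LinkedL.Linked (flip _<ᶠ_) γs → LinkedL.Linked (flip _<ᶠ_) (β ∷ γs)
      cons []      []  = [-]
      cons (γ<β ∷ _) l = γ<β ∷ l

    realize-new : Realization K′ (term c K′ g ∷ xs)
    realize-new = record
      { n = n⁺ ; G = G⁺ ; chain = chain⁺ ; end = end⁺ ; f = f⁺ ; f∈ = f∈⁺
      ; blocks  = singleton n⁺ ∷ blocks
      ; linked  = cons (All.map s≤s bounded) linked
      ; bounded = ℕ.≤-refl ∷ weaken bounded
      ; short   = s≤s short
      ; sums    = cong₂ _∷_ term⁺ (trans (sums⁺ bounded) sums)
      }

    realize-add : ∀ {y ys} → xs ≡ y ∷ ys → Realization K′ (y +⁺ term c K′ g ∷ ys)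
    realize-add {y} {ys} xs≡ = go blocks linked bounded short (trans sums xs≡)
      where
      go : ∀ βs → LinkedL.Linked (flip _<ᶠ_) βs → All (λ β → val (maxᶠ β) ≤ val n) βs → length βs ≤ val n →
           List.map (λ β → ∑[ i ∈ β ] term c (G i) (f i)) βs ≡ y ∷ ys → Realization K′ (y +⁺ term c K′ g ∷ ys)
      go (β ∷ βs) linked (β≤n ∷ bounded) short refl = record
        { n = n⁺ ; G = G⁺ ; chain = chain⁺ ; end = end⁺ ; f = f⁺ ; f∈ = f∈⁺
        ; blocks  = β⁺ ∷ βs
        ; linked  = relink linked bounded
        ; bounded = maxᶠ-≤ β⁺ (λ { _ (here refl) → ℕ.≤-refl ; t (there t∈β) → ℕ.<⇒≤ (β<n⁺ t t∈β) }) ∷ weaken bounded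
        ; short   = ℕ.m≤n⇒m≤1+n short
        ; sums    = cong₂ _∷_ sum-insert (sums⁺ bounded)
        }
        where
        β<n⁺ : ∀ t → t ∈ᶠ β → val t < val n⁺
        β<n⁺ t t∈β = s≤s (ℕ.≤-trans (≤-maxᶠ β t∈β) β≤n)

        β⁺ = insert n⁺ β β<n⁺

        sum-insert : sum⁺ β⁺ ≡ (∑[ i ∈ β ] term c (G i) (f i)) +⁺ term c K′ g
        -- `insert` puts the new index in front, whereas the state adds its term at the end.
        sum-insert = trans (cong₂ _+⁺_ term⁺ (sum⁺-≡ {β} β≤n)) (+⁺-comm (term c K′ g) (∑[ i ∈ β ] term c (G i) (f i)))

        relink : ∀ {βs} → LinkedL.Linked (flip _<ᶠ_) (β ∷ βs) → All (λ β → val (maxᶠ β) ≤ val n) βs →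
                 LinkedL.Linked (flip _<ᶠ_) (β⁺ ∷ βs)
        relink [-]       _         = [-]
        relink {γ ∷ _} (γ<β ∷ l) (γ≤n ∷ _) =
          <-minᶠ β⁺ (λ { _ (here refl) → s≤s γ≤n ; t (there t∈β) → ℕ.<-≤-trans γ<β (minᶠ-≤ β t∈β) }) ∷ l

  realize : ∀ {K x xs} → State c K x xs → Realization K (x ∷ xs)
  realize {K} (start {f = f} f∈) = record
    { n       = mkℕ⁺ 1
    ; G       = λ _ → K
    ; chain   = λ { (mkℕ⁺ (suc _)) (s≤s ()) }
    ; end     = refl
    ; f       = λ _ → f
    ; f∈      = λ _ _ → f∈
    ; blocks  = singleton (mkℕ⁺ 1) ∷ []
    ; linked  = [-]
    ; bounded = ℕ.≤-refl ∷ []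
    ; short   = ℕ.≤-refl
    ; sums    = refl
    }
  realize (new {G = G} {G′} G′⊊G s f∈) = realize-new {G′} {G} (realize s) G′⊊G f∈
  realize (add {G = G} {G′} G′⊊G s f∈) = realize-add {G′} {G} (realize s) G′⊊G f∈ refl

  state⇒conclusion : ∀ {k A} → Conclusion c k A → ∀ ys {K x xs} → State c K x xs →
                     toList ys ʳ++ [] ≡ x ∷ xs → A ys
  state⇒conclusion {k} {A} concl ys s eq =
    go (unmap-ʳ++ _ ys blocks (trans sums (sym eq)))
    where
    open Realization (realize s)
    go : (∃ λ βs → ∃ λ ws → blocks ≡ toList βs ʳ++ ws × Vec.map _ βs ≡ ys × List.map _ ws ≡ []) → A ys
    go (βs , [] , blocks≡ , refl , refl) =
      concl (val n) long G chain βs (linked-ʳ++⁻ βs (subst (LinkedL.Linked _) blocks≡ linked))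
        (last-ʳ++ βs (subst (All _) blocks≡ bounded)) f f∈
      where
      long : suc k ≤ val n
      long = subst (_≤ val n)
        (trans (cong length blocks≡)
          (trans (length-ʳ++ (toList βs)) (trans (ℕ.+-identityʳ _) (Vec.length-toList βs)))) short

-- From functions to an idempotent

append : (β γ : 𝔹) → (∀ s t → s ∈ᶠ β → t ∈ᶠ γ → val s < val t) → 𝔹
append β γ β<γ = record
  { elements = elements β List⁺.⁺++⁺ elements γ
  ; unique   = UniqueP.++⁺ ℕ⁺-setoid (unique β) (unique γ) λ (t∈β , t∈γ) → ℕ.<-irrefl refl (β<γ _ _ t∈β t∈γ)
  }

∑-append : ∀ β γ β<γ f → ∑ (append β γ β<γ) f ≡ ∑ β f +⁺ ∑ γ f
∑-append β γ β<γ f = val-injective (begin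
  val (∑ (append β γ β<γ) f)            ≡⟨ val-∑ (append β γ β<γ) f ⟩
  sum (List.map (val ∘ f) (xs List.++ ys))   ≡⟨ cong sum (map-++ (val ∘ f) xs ys) ⟩
  sum (List.map (val ∘ f) xs List.++ List.map (val ∘ f) ys)      ≡⟨ sum-++ (List.map (val ∘ f) xs) _ ⟩
  sum (List.map (val ∘ f) xs) ℕ.+ sum (List.map (val ∘ f) ys) ≡⟨ cong₂ ℕ._+_ (val-∑ β f) (val-∑ γ f) ⟨
  val (∑ β f) ℕ.+ val (∑ γ f)           ∎)
  where
  open ≡.≡-Reasoning
  xs = List⁺.toList (elements β)
  ys = List⁺.toList (elements γ)

ultrafilter-⊆⇒⊇ : ∀ {X : Set} (p q : Ultrafilter X) → (∀ A → p ∋ A → q ∋ A) → ∀ A → q ∋ A → p ∋ A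
ultrafilter-⊆⇒⊇ p q p⊆q A A∈q with Ultrafilter.maximal p A
... | inj₁ A∈p  = A∈p
... | inj₂ ∁A∈p = contradiction
  (Ultrafilter.upward q {A ∩ ∁ A} {∅} (λ (a , ∁a) → ∁a a) (Ultrafilter.meet q {A} {∁ A} A∈q (p⊆q (∁ A) ∁A∈p)))
  (Ultrafilter.proper q)

module Forward (em : ExcludedMiddle 0ℓ) (ac : AxiomOfChoice)
               (c : 𝔽 → ℕ⁺ × 𝔹)
               (increasing : ∀ F G → F ⊊ G → val (maxᶠ (proj₂ (c F))) < val (minᶠ (proj₂ (c G)))) where

  open Choice em ac
  open Filters em ac
  open Finite em

  -- The set T F of the overview, indexed also by the last set `G` of the chain, where T G can be
  -- attached.
  data Tail (F : 𝔽) : ℕ⁺ → 𝔽 → Set where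
    one  : ∀ {G f} → F ⊊ G → f ∈ᶠ G → Tail F (term c G f) G
    snoc : ∀ {G G′ x f} → Tail F x G′ → G′ ⊊ G → f ∈ᶠ G → Tail F (x +⁺ term c G f) G

  tail⇒state : ∀ {F x G} → Tail F x G → State c G x []
  tail⇒state (one _ f∈)                    = start f∈
  tail⇒state (snoc {G} {G′} t G′⊊G f∈) = add {G = G} {G′} G′⊊G (tail⇒state t) f∈

  state-tail : ∀ {F G x y xs} → State c F x xs → Tail F y G → State c G y (x ∷ xs)
  state-tail {F} {G} s (one F⊊G f∈)            = new {G = G} {F} F⊊G s f∈
  state-tail s (snoc {G} {G′} t G′⊊G f∈) = add {G = G} {G′} G′⊊G (state-tail s t) f∈

  tail-trans : ∀ {F G K x y} → Tail F x G → Tail G y K → Tail F (x +⁺ y) K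
  tail-trans s (one G⊊K f∈) = snoc s G⊊K f∈
  tail-trans {F} {x = x} s (snoc {K} {K′} {y} {f} t K′⊊K f∈) =
    subst (λ z → Tail F z K) (+⁺-assoc x y (term c K f)) (snoc (tail-trans s t) K′⊊K f∈)

  tail-mono : ∀ {F F′ G x} → (∀ {s} → s ∈ᶠ F → s ∈ᶠ F′) → Tail F′ x G → Tail F x G
  tail-mono F⊆F′ (one (F′⊆G , G⊈F′) f∈) = one ((λ s∈ → F′⊆G (F⊆F′ s∈)) , λ G⊆F → G⊈F′ (λ s∈ → F⊆F′ (G⊆F s∈))) f∈
  tail-mono F⊆F′ (snoc t G′⊊G f∈)       = snoc (tail-mono F⊆F′ t) G′⊊G f∈

  Refutes : 𝔽 → Sub ℕ⁺ → Set
  Refutes F C = ∀ a β → ¬ (∀ f → f ∈ᶠ F → (a +⁺ ∑ β f) ∈ₛ C)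

  NonJ : Sub ℕ⁺ → Set
  NonJ C = ∃ λ F → Refutes F C

  nonJ : ∀ C → ¬ IsJSet (_∈ₛ C) → NonJ C
  nonJ C ¬j with em {NonJ C}
  ... | yes r = r
  ... | no ¬r = contradiction isJ ¬j
    where
    isJ : IsJSet (_∈ₛ C)
    isJ F with em {∃ λ a → ∃ λ β → ∀ f → f ∈ᶠ F → (a +⁺ ∑ β f) ∈ₛ C}
    ... | yes j = j
    ... | no ¬j = contradiction (F , λ a β h → ¬j (a , β , h)) ¬r

  nonJ-shift : ∀ x {C} → NonJ C → NonJ (λ y → C (x +⁺ y))
  nonJ-shift x {C} (F , r) = F , λ a β h → r (x +⁺ a) β
    (λ f f∈F → subst (_∈ₛ C) (sym (+⁺-assoc x a (∑ β f))) (h f f∈F))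

  -- A larger set of functions still refutes, so the union of all witnesses refutes every set at
  -- once.
  common : ∀ F Cs → All NonJ Cs → ∃ λ F* → (∀ {s} → s ∈ᶠ F → s ∈ᶠ F*) × All (Refutes F*) Cs
  common F []       []              = F , id , []
  common F (C ∷ Cs) ((F′ , r) ∷ rs) with common F Cs rs
  ... | F* , F⊆F* , rs* = F′ ∪ F* , (λ s∈ → ⊆-∪ʳ F′ F* (F⊆F* s∈)) ,
    (λ a β h → r a β (λ f f∈ → h f (⊆-∪ˡ F′ F* f∈))) ∷
    All.map (λ r a β h → r a β (λ f f∈ → h f (⊆-∪ʳ F′ F* f∈))) rs*

  first : (ℕ⁺ → ℕ⁺) → ℕ
  first f = val (f (mkℕ⁺ 1))

  -- A constant above the sum of all values at 1 of members of `F`, hence a function outside `F`; it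
  -- gives `F` a proper superset.
  beyond : 𝔽 → ℕ⁺ → ℕ⁺
  beyond F _ = mkℕ⁺ (suc (sum (List.map first (List⁺.toList (elements F)))))

  beyond∉ : ∀ F → ¬ beyond F ∈ᶠ F
  beyond∉ F ∈F = ℕ.<-irrefl refl (bounded (List⁺.toList (elements F)) ∈F)
    where
    bounded : ∀ fs {f : ℕ⁺ → ℕ⁺} → Any (λ g → ∀ t → f t ≡ g t) fs → first f ≤ sum (List.map first fs)
    bounded (g ∷ fs) {f} (here f≗g) = ℕ.≤-trans (ℕ.≤-reflexive (cong val (f≗g (mkℕ⁺ 1)))) (ℕ.m≤m+n (first g) _)
    bounded (g ∷ fs) {f} (there f∈) = ℕ.≤-trans (bounded fs {f} f∈) (ℕ.m≤n+m _ (first g))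

  abstract

    larger : 𝔽 → 𝔽
    larger F = F ∪ fromList⁺ (beyond F ∷ [])

    ⊊-larger : ∀ F → F ⊊ larger F
    ⊊-larger F = (λ {s} s∈ → ⊆-∪ˡ F [g] {s} s∈) , λ L⊆F →
      beyond∉ F (L⊆F {beyond F} (⊆-∪ʳ F [g] {beyond F}
        (∈-fromList⁺⁺ {S = ℕ⁺^ℕ⁺} {s = beyond F} (beyond F ∷ []) (here (λ _ → refl)))))
      where
      [g] : 𝔽
      [g] = fromList⁺ (beyond F ∷ [])

  -- Words evaluated along a chain.

  module Words {L : Set} (letter : L → ℕ⁺ → ℕ⁺) where

    -- A word picks one function from each set of the chain that iterates `larger`; all words of one
    -- length share this chain.
    eval : ∀ {n} → 𝔽 → ℕ⁺ → Vec L n → ℕ⁺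
    eval G x []      = x
    eval G x (a ∷ w) = eval (larger G) (x +⁺ term c (larger G) (letter a)) w

    eval-tail : ∀ {n F G x} → (∀ a → letter a ∈ᶠ G) → Tail F x G → (w : Vec L n) → ∃ (Tail F (eval G x w))
    eval-tail           l∈ t []      = _ , t
    eval-tail {G = G} l∈ t (a ∷ w) = eval-tail (λ a → proj₁ (⊊-larger G) (l∈ a))
      (snoc t (⊊-larger G) (proj₁ (⊊-larger G) (l∈ a))) w

    -- The dependence on a letter that the definition of a J-set speaks of. `Bound` controls the
    -- maximum of β, so that later values of H can be appended.
    Affine : (ℕ → Set) → (L → ℕ⁺) → Set
    Affine Bound x = ∃ λ a → ∃ λ β → Bound (val (maxᶠ β)) × (∀ l → x l ≡ a +⁺ ∑ β (letter l))

    Below : 𝔽 → ℕ → Set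
    Below G n = n ≤ val (maxᶠ (proj₂ (c G)))

    H<larger : ∀ G {t} → t ∈ᶠ proj₂ (c (larger G)) → val (maxᶠ (proj₂ (c G))) < val t
    H<larger G t∈ = ℕ.<-≤-trans (increasing G (larger G) (⊊-larger G)) (minᶠ-≤ (proj₂ (c (larger G))) t∈)

    -- A constant letter adds its term to `a`; a variable adds its α to `a` and its H to β. Clause
    -- (a) keeps the appended piece beyond β.
    affine : ∀ {n G x} → Affine (Below G) x → (w : VarWord L n) → Affine (λ _ → ⊤) (λ l → eval G (x l) (fill l w))
    affine (a , β , _ , eq) [] = a , β , _ , eq
    affine {G = G} (a , β , β≤ , eq) (just l ∷ w) =
      affine (a +⁺ term c G⁺ (letter l) , β ,
        ℕ.≤-trans β≤ (ℕ.<⇒≤ (ℕ.<-≤-trans (H<larger G (here refl)) (≤-maxᶠ (proj₂ (c G⁺)) (here refl)))) ,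
        λ l′ → trans (cong (_+⁺ term c G⁺ (letter l)) (eq l′)) (swapʳ a (∑ β (letter l′)) (term c G⁺ (letter l)))) w
      where
      G⁺ = larger G
      swapʳ : ∀ a b c → (a +⁺ b) +⁺ c ≡ (a +⁺ c) +⁺ b
      swapʳ a b c = trans (+⁺-assoc a b c) (trans (cong (a +⁺_) (+⁺-comm b c)) (sym (+⁺-assoc a c b)))
    affine {G = G} (a , β , β≤ , eq) (nothing ∷ w) =
      affine (a +⁺ proj₁ (c G⁺) , append β γ β<γ ,
        maxᶠ-≤ (append β γ β<γ) (λ t t∈ → [ below t , ≤-maxᶠ γ ]′ (AnyP.++⁻ _ t∈)) ,
        λ l → trans (cong (_+⁺ term c G⁺ (letter l)) (eq l))
          (trans (+⁺-interchange a (∑ β (letter l)) (proj₁ (c G⁺)) (∑ γ (letter l)))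
                 (cong ((a +⁺ proj₁ (c G⁺)) +⁺_) (sym (∑-append β γ β<γ (letter l)))))) w
      where
      G⁺ = larger G
      γ = proj₂ (c G⁺)

      β<γ : ∀ s t → s ∈ᶠ β → t ∈ᶠ γ → val s < val t
      β<γ s t s∈ t∈ = ℕ.≤-<-trans (ℕ.≤-trans (≤-maxᶠ β s∈) β≤) (H<larger G t∈)

      below : ∀ t → t ∈ᶠ β → val t ≤ val (maxᶠ γ)
      below t t∈ = ℕ.≤-trans (ℕ.<⇒≤ (β<γ t _ t∈ (here refl))) (≤-maxᶠ γ (here refl))

    -- Nothing depends on the letter before the first variable, whose H is the initial nonempty β.
    affine-line : ∀ {n G x} (w : VarWord L n) → HasVar w → Affine (λ _ → ⊤) (λ l → eval G x (fill l w))
    affine-line {G = G} {x} (just a ∷ w) (there v) = affine-line {x = x +⁺ term c (larger G) (letter a)} w v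
    affine-line {G = G} {x} (nothing ∷ w) _ =
      affine (x +⁺ proj₁ (c (larger G)) , proj₂ (c (larger G)) , ℕ.≤-refl ,
        λ l → sym (+⁺-assoc x (proj₁ (c (larger G))) (∑ (proj₂ (c (larger G))) (letter l)))) w

  tails-uncoverable : ∀ F Cs → All NonJ Cs → ¬ (∀ x G → Tail F x G → Any (x ∈ₛ_) Cs)
  tails-uncoverable F Cs non cover with common F Cs non
  ... | F* , F⊆F* , refuted with hales-jewett (length (List⁺.tail (elements F*))) (length Cs)
  -- The colour of a word is the position in `Cs` of a set that contains its value.
  ... | n , hj = result (hj (λ w → Any.index (covered w)))
    where
    fs = List⁺.toList (elements F*)
    letter = List.lookup fs
    open Words letter

    letter∈ : ∀ a → letter a ∈ᶠ F*
    letter∈ a = Any.map (λ { refl _ → refl }) (∈-lookup {xs = fs} a)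

    -- A tail has at least one term; an arbitrary letter supplies it before the word starts.
    G₀ = larger F*
    x₀ = term c G₀ (letter zero)

    covered : ∀ (w : Vec (Fin (length fs)) n) → Any (eval G₀ x₀ w ∈ₛ_) Cs
    covered w with eval-tail {F = F*} (λ a → proj₁ (⊊-larger F*) (letter∈ a))
                     (one (⊊-larger F*) (proj₁ (⊊-larger F*) (letter∈ zero))) w
    ... | G , t = cover _ G (tail-mono F⊆F* t)

    result : ¬ Monochromatic (λ w → Any.index (covered w))
    result (l , v , mono) with affine-line {G = G₀} {x₀} l v
    ... | a , β , _ , eq = All.lookup refuted (∈-lookup i) a β λ f f∈ →
      subst (_∈ₛ C)
        (trans (eq (Any.index f∈)) (cong (a +⁺_) (∑-cong β (λ t _ → sym (AnyP.lookup-index f∈ t)))))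
        (in-C (Any.index f∈))
      where
      i = Any.index (covered (fill zero l))
      C = List.lookup Cs i
      in-C : ∀ b → eval G₀ x₀ (fill b l) ∈ₛ C
      in-C b = subst (λ j → eval G₀ x₀ (fill b l) ∈ₛ List.lookup Cs j) (mono b zero)
        (AnyP.lookup-index (covered (fill b l)))

  -- The filter of the closed subsemigroup inside `𝒥`.

  Base : Sub ℕ⁺ → Set
  Base B = ∃ λ F → ∃ λ Cs → All NonJ Cs × (∀ x G → Tail F x G → x ∈ₛ B ⊎ Any (x ∈ₛ_) Cs)

  -- Its ultrafilter extensions are the members of 𝒥 that contain every {x : ∃ (Tail F x)}.
  base : Sub (Sub ℕ⁺)
  base = ⟦ Base ⟧

  F₀ : 𝔽
  F₀ = fromList⁺ (id ∷ [])

  base-isFilter : IsFilterₛ base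
  base-isFilter = record
    { univ   = ⟦⟧⁺ Base (F₀ , [] , [] , λ _ _ _ → inj₁ tt)
    ; upward = λ A⊑B A∈ → let F , Cs , non , cover = ⟦⟧⁻ Base A∈ in
        ⟦⟧⁺ Base (F , Cs , non , λ x G t → Sum.map₁ (A⊑B x) (cover x G t))
    ; meet   = λ A∈ B∈ →
        let F , Cs , non , cover = ⟦⟧⁻ Base A∈
            F′ , Cs′ , non′ , cover′ = ⟦⟧⁻ Base B∈
        in ⟦⟧⁺ Base (F ∪ F′ , Cs List.++ Cs′ , AllP.++⁺ non non′ , λ x G t →
             combine (cover x G (tail-mono (⊆-∪ˡ F F′) t)) (cover′ x G (tail-mono (⊆-∪ʳ F F′) t)))
    ; proper = λ ∅∈ → let F , Cs , non , cover = ⟦⟧⁻ Base ∅∈ in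
        tails-uncoverable F Cs non (λ x G t → [ (λ ()) , id ]′ (cover x G t))
    }
    where
    combine : ∀ {a b} {Cs Cs′ : List (Sub ℕ⁺)} {x} → T a ⊎ Any (x ∈ₛ_) Cs → T b ⊎ Any (x ∈ₛ_) Cs′ →
              T (a ∧ b) ⊎ Any (x ∈ₛ_) (Cs List.++ Cs′)
    combine (inj₁ a) (inj₁ b) = inj₁ (T-∧⁺ a b)
    combine (inj₂ c) _        = inj₂ (AnyP.++⁺ˡ c)
    combine (inj₁ _) (inj₂ c) = inj₂ (AnyP.++⁺ʳ _ c)

  -- If a chain for `x` ends in `G`, then x + T G lies in T F, and translates of the exceptional
  -- sets are still not J-sets. So the translate of `B` by `x` is in `base`, hence in `q`.
  base-isAdditive : IsAdditive base
  base-isAdditive = base-isFilter , λ q uq base⊑q B B∈ →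
    let F , Cs , non , cover = ⟦⟧⁻ Base B∈ in
    ⟦⟧⁺ Base (F , Cs , non , λ x G t → inj₁ (base⊑q _ (⟦⟧⁺ Base
      (G , List.map (λ C y → C (x +⁺ y)) Cs , AllP.map⁺ (All.map (λ {C} → nonJ-shift x {C}) non) ,
       λ y K t′ → Sum.map₂ AnyP.map⁺ (cover (x +⁺ y) K (tail-trans t t′))))))

  toUltrafilter : ∀ {p : Sub (Sub ℕ⁺)} → IsUltraₛ p → βℕ
  toUltrafilter {p} up = record
    { sets          = λ A → ⟦ A ⟧ ∈ₛ p
    ; isUltrafilter = record
      { univ    = p.all (λ x → ⟦⟧⁺ {ℕ⁺} U {x} tt)
      ; upward  = λ {A} {B} A⊆B → p.upward (λ x → ⟦⟧⁺ B ∘ A⊆B ∘ ⟦⟧⁻ A)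
      ; meet    = λ {A} {B} → p.upward₂ (λ x a b → ⟦⟧⁺ (A ∩ B) (⟦⟧⁻ A a , ⟦⟧⁻ B b))
      ; proper  = λ ∅∈ → p.proper (p.upward (λ x → ⟦⟧⁻ {ℕ⁺} ∅ {x}) ∅∈)
      ; maximal = λ A → Sum.map₂ (p.upward (λ x ∁a → ⟦⟧⁺ (∁ A) (T-not ∁a ∘ ⟦⟧⁺ A))) (p.maximal ⟦ A ⟧)
      }
    }
    where module p = IsUltraₛ up

  module Extension {p} (up : IsUltraₛ p) (base⊑p : base ⊑ p) (p⊑p⊙p : p ⊑ p ⊙ p) where

    private
      module p = IsUltraₛ up
      p̂ = toUltrafilter up

    tails∈ : ∀ F → p̂ ∋ λ x → ∃ (Tail F x)
    tails∈ F = base⊑p _ (⟦⟧⁺ Base (F , [] , [] , λ x G t → inj₁ (⟦⟧⁺ (λ x → ∃ (Tail F x)) (G , t))))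

    ∁nonJ∈base : ∀ C → NonJ C → (not ∘ C) ∈ₛ base
    ∁nonJ∈base C non = ⟦⟧⁺ Base (F₀ , C ∷ [] , non ∷ [] , λ x G t → decide x)
      where
      decide : ∀ x → x ∈ₛ (not ∘ C) ⊎ Any (x ∈ₛ_) (C ∷ [])
      decide x with em {x ∈ₛ C}
      ... | yes x∈C = inj₂ (here x∈C)
      ... | no  x∉C = inj₁ (T-not⁺ x∉C)

    ∈𝒥 : 𝒥 p̂
    ∈𝒥 A A∈ F = go em
      where
      go : Dec (IsJSet (_∈ₛ ⟦ A ⟧)) → ∃ λ a → ∃ λ β → ∀ f → f ∈ᶠ F → A (a +⁺ ∑ β f)
      go (yes j) = let a , β , h = j F in a , β , λ f f∈ → ⟦⟧⁻ A (h f f∈)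
      go (no ¬j) = contradiction (λ x a ∁a → T-not ∁a a)
        (p.disjoint A∈ (base⊑p _ (∁nonJ∈base ⟦ A ⟧ (nonJ ⟦ A ⟧ ¬j))))

    p⊆p⊕p : ∀ A → p̂ ∋ A → p̂ ⊕ p̂ ∋ A
    p⊆p⊕p A A∈ = p.upward
      (λ x → ⟦⟧⁺ (λ x → p̂ ∋ λ y → A (x +⁺ y)) {x} ∘
        p.upward (λ y → ⟦⟧⁺ (λ y → A (x +⁺ y)) {y} ∘ ⟦⟧⁻ A {x +⁺ y}))
      (p⊑p⊙p ⟦ A ⟧ A∈)

    isIdempotent : IsIdempotent p̂
    isIdempotent = (λ {A} → ultrafilter-⊆⇒⊇ p̂ (p̂ ⊕ p̂) p⊆p⊕p A) , λ {A} → p⊆p⊕p A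

  idempotent : ∃ λ p → 𝒥 p × IsIdempotent p × (∀ F → p ∋ λ x → ∃ (Tail F x))
  idempotent =
    let p , up , base⊑p , p⊑p⊙p = idempotent-exists base-isAdditive
        open Extension up base⊑p p⊑p⊙p
    in toUltrafilter up , ∈𝒥 , isIdempotent , tails∈

  -- The nodes of the tree are the prefixes reached by states; a state ending in `F` is continued by
  -- every member of T F, which is in `p`.
  tails⇒⨂ : ∀ {k A} (p : βℕ) → (∀ F → p ∋ λ x → ∃ (Tail F x)) → Conclusion c k A → ⨂ {k} (λ _ → p) ∋ A
  tails⇒⨂ {k} {A} p tails concl = Tensor.tree⇒⨂ p record
    { D      = D
    ; root   = tt
    ; branch = branch
    ; leaf   = λ ys → leaf ys _ refl
    }
    where
    D : Pred (List ℕ⁺) 0ℓ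
    D []       = ⊤
    D (x ∷ xs) = ∃ λ G → State c G x xs

    branch : ∀ xs → D xs → p ∋ λ y → D (y ∷ xs)
    branch []       _       = Ultrafilter.upward p (λ (G , t) → G , tail⇒state t) (tails F₀)
    branch (x ∷ xs) (F , s) = Ultrafilter.upward p (λ (G , t) → G , state-tail s t) (tails F)

    leaf : ∀ ys zs → toList ys ʳ++ [] ≡ zs → D zs → A ys
    leaf ys       (x ∷ xs) eq (G , s) = state⇒conclusion c concl ys s eq
    leaf (y ∷ ys) []       eq _       with () ← trans (sym (length-ʳ++ (toList (y ∷ ys)))) (cong length eq)

  forward : ∀ {k A} → Conclusion c k A → ∃ λ p → 𝒥 p × IsIdempotent p × (⨂ {k} (λ _ → p) ∋ A)
  forward concl = let p , J , idem , tails = idempotent in p , J , idem , tails⇒⨂ p tails concl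

-- From an idempotent to functions

shiftᶠ : ℕ⁺ → 𝔹 → 𝔹
shiftᶠ n β = record
  { elements = List⁺.map (_+⁺ n) (elements β)
  ; unique   = UniqueP.map⁺ ℕ⁺-setoid ℕ⁺-setoid
      (λ {s t} eq → val-injective {s} {t}
        (ℕ.+-cancelʳ-≡ (val n) (val s) (val t) (cong val {s +⁺ n} {t +⁺ n} eq))) (unique β)
  }

∑-shift : ∀ n β f → ∑ (shiftᶠ n β) f ≡ (∑[ t ∈ β ] f (t +⁺ n))
∑-shift n β f = val-injective (trans (val-∑ (shiftᶠ n β) f)
  (trans (cong sum (sym (map-∘ {g = val ∘ f} {f = _+⁺ n} (List⁺.toList (elements β)))))
         (sym (val-∑ β (λ t → f (t +⁺ n))))))

<-min-shiftᶠ : ∀ n β → val n < val (minᶠ (shiftᶠ n β))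
<-min-shiftᶠ n β = <-minᶠ (shiftᶠ n β) λ t t∈ →
  let s , _ , eq = Mem.∈-map⁻ ℕ⁺-setoid ℕ⁺-setoid {xs = List⁺.toList (elements β)} t∈
  in subst (λ t → val n < val t) (sym eq) (ℕ.m<n+m (val n) (val>0 s))

module Backward (em : ExcludedMiddle 0ℓ) (ac : AxiomOfChoice)
                (p : βℕ) (J : 𝒥 p) (idem : IsIdempotent p)
                {k : ℕ} {A : Pred (Vec ℕ⁺ (suc k)) 0ℓ} (tree : Tensor.Tree p k A) where

  open Choice em ac
  open Finite em
  open Tensor.Tree tree

  private module p = Ultrafilter p

  p-isMeetClosed : IsMeetClosed (p ∋_)
  p-isMeetClosed = record { univ = p.univ ; upward = p.upward ; meet = p.meet }

  -- Applying the J-set property to the functions shifted by n + 1 moves β past `n`.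
  isJSet-beyond : ∀ {B} → IsJSet B → ∀ (F : 𝔽) n →
                  ∃ λ a → ∃ λ β → n < val (minᶠ β) × (∀ f → f ∈ᶠ F → B (a +⁺ ∑ β f))
  isJSet-beyond {B} j F n =
    let a , β , h = j (fromList⁺ shifted)
    in a , shiftᶠ n⁺ β , ℕ.<-trans (ℕ.n<1+n n) (<-min-shiftᶠ n⁺ β) , λ f f∈ →
      subst (λ s → B (a +⁺ s)) (sym (∑-shift n⁺ β f)) (h (shift f) (∈-fromList⁺⁺ {S = ℕ⁺^ℕ⁺} {s = shift f} shifted
        (Mem.∈-map⁺ ℕ⁺^ℕ⁺ ℕ⁺^ℕ⁺ {f = shift} (λ f≗g t → f≗g (t +⁺ n⁺)) {v = f} f∈)))
    where
    n⁺ = mkℕ⁺ (suc n)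

    shift : (ℕ⁺ → ℕ⁺) → ℕ⁺ → ℕ⁺
    shift f t = f (t +⁺ n⁺)

    shifted : List⁺ (ℕ⁺ → ℕ⁺)
    shifted = List⁺.map shift (elements F)

  -- The set B* of y ∈ B with -y + B ∈ p, for B = {y : D (y ∷ xs)}.
  Star : List ℕ⁺ → ℕ⁺ → Set
  Star xs y = D (y ∷ xs) × (p ∋ λ z → D ((y +⁺ z) ∷ xs))

  star∈ : ∀ xs → D xs → p ∋ Star xs
  star∈ xs d = p.meet (branch xs d) (proj₂ idem {λ y → D (y ∷ xs)} (branch xs d))

  -- The usual stability of B*: by idempotence, -y + B in `p` implies that -z + (-y + B) is in `p`
  -- for `p`-many z.
  star-+ : ∀ xs y → Star xs y → p ∋ λ z → Star xs (y +⁺ z)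
  star-+ xs y (_ , h) = p.meet h
    (p.upward (λ {z} → p.upward λ {w} → subst (λ u → D (u ∷ xs)) (sym (+⁺-assoc y z w)))
      (proj₂ idem {λ z → D ((y +⁺ z) ∷ xs)} h))

  -- The recursive choice of α and H.

  Choices : Set
  Choices = 𝔽 → ℕ⁺ × 𝔹

  -- The three clauses match `start`, `new` and `add`: however `z` continues a state below `F`, the
  -- outcome stays in the starred set.
  Fits : Choices → 𝔽 → ℕ⁺ → Set
  Fits c F z = Star [] z ×
    (∀ G → G ⊊ F → ∀ x xs → State c G x xs → Star (x ∷ xs) z × Star xs (x +⁺ z))

  Step : Choices → 𝔽 → ℕ⁺ × 𝔹 → Set
  Step c F (a , β) =
    (∀ G → G ⊊ F → val (maxᶠ (proj₂ (c G))) < val (minᶠ β)) ×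
    (∀ f → f ∈ᶠ F → Fits c F (a +⁺ ∑ β f))

  Agree : Choices → Choices → 𝔽 → Set
  Agree c c′ F = ∀ G → G ⊊ F → c G ≡ c′ G

  state-agree : ∀ {c c′ F} → Agree c c′ F → ∀ {G x xs} → G ⊊ F → State c G x xs → State c′ G x xs
  state-agree {c} {c′} agree {G} G⊊F (start {f = f} f∈) =
    subst (λ (a , β) → State c′ G (a +⁺ ∑ β f) []) (sym (agree G G⊊F)) (start f∈)
  state-agree {c} {c′} {F} agree {G} G⊊F (new {G′ = G′} {x} {xs} {f} G′⊊G s f∈) =
    subst (λ (a , β) → State c′ G (a +⁺ ∑ β f) (x ∷ xs)) (sym (agree G G⊊F))
      (new {G = G} {G′} G′⊊G (state-agree {F = F} agree {G′} (⊊-trans {F = G′} {G} {F} G′⊊G G⊊F) s) f∈)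
  state-agree {c} {c′} {F} agree {G} G⊊F (add {G′ = G′} {x} {xs} {f} G′⊊G s f∈) =
    subst (λ (a , β) → State c′ G (x +⁺ (a +⁺ ∑ β f)) xs) (sym (agree G G⊊F))
      (add {G = G} {G′} G′⊊G (state-agree {F = F} agree {G′} (⊊-trans {F = G′} {G} {F} G′⊊G G⊊F) s) f∈)

  -- The requirement at `F` consults the choices at proper subsets of `F` alone, which permits
  -- recursion on size.
  step-agree : ∀ {c c′ F} → Agree c c′ F → Step c F ⊆ Step c′ F
  step-agree {c} {c′} {F} agree {a , β} (late , fits) =
    (λ G G⊊F → subst (λ q → val (maxᶠ (proj₂ q)) < val (minᶠ β)) (agree G G⊊F) (late G G⊊F)) ,
    λ f f∈ → let s , h = fits f f∈ in
      s , λ G G⊊F x xs st → h G G⊊F x xs (state-agree {F = F} (λ G G⊊F → sym (agree G G⊊F)) {G} G⊊F st)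

  step-resp : ∀ {c F F′} → F ≈ᶠ F′ → Step c F ⊆ Step c F′
  step-resp {c} {F} {F′} (F⊆F′ , F′⊆F) {a , β} (late , fits) =
    (λ G G⊊F′ → late G (back G G⊊F′)) ,
    λ f f∈ → let s , h = fits f (F′⊆F f∈) in s , λ G G⊊F′ → h G (back G G⊊F′)
    where
    back : ∀ G → G ⊊ F′ → G ⊊ F
    back G = ⊊-respʳ {F = G} {F′} {F} ((λ {s} → F′⊆F {s}) , λ {s} → F⊆F′ {s})

  private
    default : ℕ⁺ × 𝔹
    default = mkℕ⁺ 1 , fromList⁺ (mkℕ⁺ 1 ∷ [])

    ε      = proj₁ (selector (ℕ⁺ × 𝔹) default)
    ε-spec = proj₁ (proj₂ (selector (ℕ⁺ × 𝔹) default))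
    ε-ext  = proj₂ (proj₂ (selector (ℕ⁺ × 𝔹) default))

  approx : ℕ → Choices
  approx zero    F = default
  approx (suc n) F = ε (Step (approx n) F)

  -- Proper subsets are smaller, so by induction both requirements at `F` are equivalent;
  -- extensionality of `ε` makes the chosen values equal.
  approx-stable : ∀ m n F → size F ≤ m → size F ≤ n → approx m F ≡ approx n F
  approx-stable (suc m) (suc n) F (s≤s F≤m) (s≤s F≤n) =
    ε-ext _ _
      ( (λ {q} → step-agree {F = F} agree {q})
      , (λ {q} → step-agree {F = F} (λ G G⊊F → sym (agree G G⊊F)) {q}))
    where
    agree : Agree (approx m) (approx n) F
    agree G G⊊F = approx-stable m n G (ℕ.≤-trans G≤ F≤m) (ℕ.≤-trans G≤ F≤n)
      where G≤ = ℕ.≤-pred (⊊⇒size< {G = G} {F} G⊊F)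

  c : Choices
  c F = approx (size F) F

  c-unfold : ∀ F → c F ≡ ε (Step c F)
  c-unfold F = ε-ext _ _
      ( (λ {q} → step-agree {F = F} agree {q})
      , (λ {q} → step-agree {F = F} (λ G G⊊F → sym (agree G G⊊F)) {q}))
    where
    agree : Agree (approx (ℕ.pred (size F))) c F
    agree G G⊊F = approx-stable (ℕ.pred (size F)) (size G) G (ℕ.≤-pred (⊊⇒size< {G = G} {F} G⊊F)) ℕ.≤-refl

  -- Two enumerations of one set pose equivalent requirements, so the values agree; thus α and H are
  -- functions of sets.
  c-cong : ∀ {F F′} → F ≈ᶠ F′ → c F ≡ c F′
  c-cong {F} {F′} (F⊆F′ , F′⊆F) = trans (c-unfold F) (trans (ε-ext _ _
    ( (λ {q} → step-resp {F = F} {F′} ((λ {s} → F⊆F′ {s}) , λ {s} → F′⊆F {s}) {q})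
    , (λ {q} → step-resp {F = F′} {F} ((λ {s} → F′⊆F {s}) , λ {s} → F⊆F′ {s}) {q}))) (sym (c-unfold F′)))

  state-resp : ∀ {G G′} → G ≈ᶠ G′ → ∀ {x xs} → State c G x xs → State c G′ x xs
  state-resp {G} {G′} e (start {f = f} f∈) =
    subst (λ (a , β) → State c G′ (a +⁺ ∑ β f) []) (sym (c-cong {G} {G′} e)) (start (proj₁ e f∈))
  state-resp {G} {G′} e (new {G′ = K} {x} {xs} {f} K⊊G s f∈) =
    subst (λ (a , β) → State c G′ (a +⁺ ∑ β f) (x ∷ xs)) (sym (c-cong {G} {G′} e))
      (new {G = G′} {K} (⊊-respʳ {F = K} {G} {G′} e K⊊G) s (proj₁ e f∈))
  state-resp {G} {G′} e (add {G′ = K} {x} {xs} {f} K⊊G s f∈) =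
    subst (λ (a , β) → State c G′ (x +⁺ (a +⁺ ∑ β f)) xs) (sym (c-cong {G} {G′} e))
      (add {G = G′} {K} (⊊-respʳ {F = K} {G} {G′} e K⊊G) s (proj₁ e f∈))

  -- There are only finitely many states below F, so a family of members of p
  -- indexed by them has its intersection in p.
  all-states : ∀ n F → size F ≤ n → (Q : ℕ⁺ → List ℕ⁺ → Pred ℕ⁺ 0ℓ) →
               (∀ G → G ⊊ F → ∀ x xs → State c G x xs → p ∋ Q x xs) →
               p ∋ λ z → ∀ G → G ⊊ F → ∀ x xs → State c G x xs → Q x xs z
  all-states (suc n) F (s≤s F≤n) Q h =
    all-⊊ p-isMeetClosed F (λ G z → ∀ x xs → State c G x xs → Q x xs z)
      (λ {G} {G′} (G⊆ , ⊆G) q x xs s → q x xs (state-resp {G′} {G} ((λ {s} → ⊆G {s}) , λ {s} → G⊆ {s}) s))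
      λ G G⊊F → p.upward (λ {z} → cases G z)
        (p.meet
          (all-∈ᶠ G (λ f z → Q (term c G f) [] z) (resp G (λ t → t) [])
            (λ f f∈ → h G G⊊F _ _ (start f∈)))
          -- A state at `G` made by `new` or `add` comes from a state below `G`; the recursive call
          -- handles both continuations together.
          (all-states n G (ℕ.≤-trans (ℕ.≤-pred (⊊⇒size< {G = G} {F} G⊊F)) F≤n) (Continued G) λ K K⊊G x xs s →
            p.meet
              (all-∈ᶠ G (λ f z → Q (term c G f) (x ∷ xs) z) (resp G (λ t → t) (x ∷ xs))
                (λ f f∈ → h G G⊊F _ _ (new {G = G} {K} K⊊G s f∈)))
              (all-∈ᶠ G (λ f z → Q (x +⁺ term c G f) xs z) (resp G (x +⁺_) xs)
                (λ f f∈ → h G G⊊F _ _ (add {G = G} {K} K⊊G s f∈)))))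
    where
    open IsMeetClosed p-isMeetClosed using (all-∈ᶠ)

    Continued : 𝔽 → ℕ⁺ → List ℕ⁺ → Pred ℕ⁺ 0ℓ
    Continued G x xs z =
      (∀ f → f ∈ᶠ G → Q (term c G f) (x ∷ xs) z) × (∀ f → f ∈ᶠ G → Q (x +⁺ term c G f) xs z)

    resp : ∀ G (g : ℕ⁺ → ℕ⁺) xs {f f′ : ℕ⁺ → ℕ⁺} → (∀ t → f t ≡ f′ t) →
           ∀ {z} → Q (g (term c G f)) xs z → Q (g (term c G f′)) xs z
    resp G g xs f≗f′ {z} = subst (λ s → Q (g (proj₁ (c G) +⁺ s)) xs z) (∑-cong (proj₂ (c G)) (λ t _ → f≗f′ t))

    cases : ∀ G z → ((∀ f → f ∈ᶠ G → Q (term c G f) [] z) ×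
                     (∀ K → K ⊊ G → ∀ x xs → State c K x xs → Continued G x xs z)) →
            ∀ x xs → State c G x xs → Q x xs z
    cases G z (q , qs) _ _ (start f∈)                 = q _ f∈
    cases G z (q , qs) _ _ (new {G′ = K} K⊊G s f∈) = proj₁ (qs K K⊊G _ _ s) _ f∈
    cases G z (q , qs) _ _ (add {G′ = K} K⊊G s f∈) = proj₂ (qs K K⊊G _ _ s) _ f∈

  state⇒star : ∀ {G x xs} → Step c G (c G) → State c G x xs → Star xs x
  state⇒star (_ , fits) (start f∈)                 = proj₁ (fits _ f∈)
  state⇒star (_ , fits) (new {G′ = K} K⊊G s f∈) = proj₁ (proj₂ (fits _ f∈) K K⊊G _ _ s)
  state⇒star (_ , fits) (add {G′ = K} K⊊G s f∈) = proj₂ (proj₂ (fits _ f∈) K K⊊G _ _ s)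

  -- `Fits c F` belongs to `p` and so is a J-set; choosing β beyond every `H` already assigned below
  -- `F` secures clause (a).
  step-exists : ∀ F → (∀ G → G ⊊ F → Step c G (c G)) → ∃ (Step c F)
  step-exists F below =
    let n , late = all-⊊ eventually-isMeetClosed F (λ G n → val (maxᶠ (proj₂ (c G))) ≤ n)
                     (λ {G} {G′} e {n} → subst (λ q → val (maxᶠ (proj₂ q)) ≤ n) (c-cong {G} {G′} e))
                     (λ G _ → _ , λ n → id)
        a , β , n<β , h = isJSet-beyond {Fits c F} (J (Fits c F) fits∈) F n
    in (a , β) , (λ G G⊊F → ℕ.≤-<-trans (late n ℕ.≤-refl G G⊊F) n<β) , h
    where
    fits∈ : p ∋ Fits c F
    fits∈ = p.meet (star∈ [] root)
      (all-states (size F) F ℕ.≤-refl (λ x xs z → Star (x ∷ xs) z × Star xs (x +⁺ z)) λ G G⊊F x xs s →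
        let star = state⇒star {G} (below G G⊊F) s
        in p.meet (star∈ (x ∷ xs) (proj₁ star)) (star-+ xs x star))

  c-spec : ∀ F → Step c F (c F)
  c-spec F = go (size F) F ℕ.≤-refl
    where
    go : ∀ n F → size F ≤ n → Step c F (c F)
    go (suc n) F (s≤s F≤n) = subst (Step c F) (sym (c-unfold F)) (ε-spec (Step c F)
      (step-exists F (λ G G⊊F → go n G (ℕ.≤-trans (ℕ.≤-pred (⊊⇒size< {G = G} {F} G⊊F)) F≤n))))

  α : Func (𝒫f-setoid ℕ⁺^ℕ⁺) ℕ⁺-setoid
  α = record { to = proj₁ ∘ c ; cong = λ {F} {F′} e → cong proj₁ (c-cong {F} {F′} e) }

  H : Func (𝒫f-setoid ℕ⁺^ℕ⁺) (𝒫f-setoid ℕ⁺-setoid)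
  H = record { to = proj₂ ∘ c ; cong = λ {F} {F′} e → ≡⇒≈ᶠ (cong proj₂ (c-cong {F} {F′} e)) }
    where
    ≡⇒≈ᶠ : ∀ {β γ : 𝔹} → β ≡ γ → β ≈ᶠ γ
    ≡⇒≈ᶠ refl = id , id

  increasing : ∀ F G → F ⊊ G → val (maxᶠ (H ⟨$⟩ F)) < val (minᶠ (H ⟨$⟩ G))
  increasing F G = proj₁ (c-spec G) F

  conclusion : Conclusion c k A
  conclusion n _ G chain β linked β≤n f f∈ =
    -- The block sums form a state, so the whole tuple is a full branch of the tree.
    let i , x , xs , s , eq = Run.run c {n} {G} chain {f} f∈ β linked β≤n
    in leaf _ (subst D (sym eq) (proj₁ (state⇒star {G i} (c-spec (G i)) s)))

theorem1p23 : ExcludedMiddle 0ℓ → AxiomOfChoice →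
    (k : ℕ) → let m = suc k in
    (A : Pred (Vec ℕ⁺ m) 0ℓ) →
    (∃ λ (α : Func (𝒫f-setoid ℕ⁺^ℕ⁺) ℕ⁺-setoid) →
    ∃ λ (H : Func (𝒫f-setoid ℕ⁺^ℕ⁺) (𝒫f-setoid ℕ⁺-setoid)) →
    (∀ F G → F ⊊ G → val (maxᶠ (H ⟨$⟩ F)) < val (minᶠ (H ⟨$⟩ G)))
    ×
    (∀ (n : ℕ) → m ≤ n →
    (G : ℕ⁺ → 𝒫f ℕ⁺^ℕ⁺) → (∀ i → val i < n → G i ⊊ G (suc⁺ i)) →
    (β : Vec (𝒫f ℕ⁺-setoid) m) → Linked _<ᶠ_ β → val (maxᶠ (last β)) ≤ n →
    (f : ℕ⁺ → ℕ⁺ → ℕ⁺) → (∀ i → val i ≤ n → f i ∈ᶠ G i) →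
    A (map (λ βⱼ → ∑[ i ∈ βⱼ ] ((α ⟨$⟩ G i) +⁺ (∑[ t ∈ H ⟨$⟩ G i ] f i t))) β)))
    ⇔
    (∃ λ (p : βℕ) → 𝒥 p × IsIdempotent p × (⨂ {k} (λ _ → p) ∋ A))
theorem1p23 em ac k A = mk⇔
  (λ (α , H , increasing , conclusion) →
    Forward.forward em ac (λ G → α ⟨$⟩ G , H ⟨$⟩ G) increasing conclusion)
  (λ (p , p∈𝒥 , idem , A∈) →
    let open Backward em ac p p∈𝒥 idem (Tensor.⨂⇒tree p {k} {A} A∈)
    in α , H , increasing , conclusion)
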